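{- For $k\ge1$ let $L_k=\frac12(3^k-1)=(1^k)_3$. (1) The path set presentation $(\mathcal{G}(L_k),v_0)$ for the path set $X(1,L_k)$ underlying $\mathcal{C}(1,L_k)$ has exactly $k$ vertices and is strongly connected. (2) For every $k\ge1$, $$\dim_H(\mathcal{C}(1,L_k))=\log_3\beta_k,$$ where $\beta_k$ is the unique real root greater than $1$ of $\lambda^k-\lambda^{k-1}-1=0$. (3) For all $k\ge3$, $$\dim_H(\mathcal{C}(1,L_k))=\frac{\log_3 k}{k}+O\!\left(\frac{\log\log k}{k}\right).$$
   Context: $\mathbb{Z}_3$ denotes the $3$-adic integers with the $3$-adic metric ($|3|_3=1/3$), and $\dim_H$ is Hausdorff dimension with respect to it. $\Sigma_3\subset\mathbb{Z}_3$ is the set of all $\sum_{j\ge0}a_j3^j$ with every $a_j\in\{0,1\}$. For an integer $M\ge1$, $\mathcal{C}(1,M)=\{\lambda\in\Sigma_3:M\lambda\in\Sigma_3\}$. The notation $(b_m\cdots b_1b_0)_3$ means $\sum_j b_j3^j$, and $(1^k)_3$ has $k$ digits equal to $1$. For $M\equiv1\pmod 3$, $X(1,M)\subset\{0,1\}^{\mathbb{N}}$ is the set of digit sequences $(a_0,a_1,\ldots)$ of elements $\sum a_j3^j$ of $\mathcal{C}(1,M)$, and its presentation $(\mathcal{G}(M),v_0)$ is the following labeled directed graph. From a vertex $v_N$ ($N$ a nonnegative integer) there is an outgoing edge labeled $a\in\{0,1\}$ exactly when $a+N\equiv0$ or $1\pmod3$, and this edge goes to $v_{N'}$ with $N'=\lfloor\frac{N+Ma}{3}\rfloor$.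 The vertices of $\mathcal{G}(M)$ are exactly those reachable from the marked vertex $v_0$ by such edges (a finite set). A directed graph is strongly connected if for any two vertices $i,j$ there is a directed path from $i$ to $j$. -}

module Defs where

open import Level using (0ℓ; Lift) renaming (suc to lsuc)
open import Algebra.Bundles using (CommutativeRing; Semiring)
import Algebra.Definitions.RawSemiring
open import Axiom.ExcludedMiddle using (ExcludedMiddle)
open import Data.Fin.Base using (Fin; toℕ)
open import Data.Nat.Base as ℕ using (ℕ; zero; suc; _∸_; _!)
open import Data.Nat.DivMod using (_/_; _%_; _mod_)
open import Data.Nat.Properties using (m^n≢0)
open import Data.Product.Base using (Σ-syntax; ∃; ∃-syntax; _×_; _,_; proj₁)
open import Data.Sum.Base using (_⊎_)
open import Function.Bundles using (_⇔_)
open import Function.Definitions using (Injective)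
open import Relation.Binary.Construct.Closure.ReflexiveTransitive using (Star)
open import Relation.Binary.Core using (Rel)
open import Relation.Binary.PropositionalEquality.Core using (_≡_; _≢_)
open import Relation.Binary.Structures using (IsTotalOrder)
open import Relation.Nullary using (¬_; yes; no)
open import Relation.Unary using (Pred; _∈_; _⊆_; ⋃)

-- An element of ℤ₃ is its sequence of 3-adic digits.

ℤ₃ : Set
ℤ₃ = ℕ → Fin 3

-- The residue Σ_{j<n} x_j 3^j of x modulo 3^n.

truncate : ℤ₃ → ℕ → ℕ
truncate x zero    = 0
truncate x (suc n) = truncate x n ℕ.+ toℕ (x n) ℕ.* 3 ℕ.^ n

digit : ℕ → ℤ₃
digit m n = _/_ m (3 ℕ.^ n) {{m^n≢0 3 n}} mod 3

-- Digit n of a 3-adic integer depends only on its residue modulo 3^(n+1),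
-- and residues multiply; digit also serves as the embedding ℕ → ℤ₃.

infixl 7 _*₃_
_*₃_ : ℤ₃ → ℤ₃ → ℤ₃
(x *₃ y) n = digit (truncate x (suc n) ℕ.* truncate y (suc n)) n

Σ₃ : Pred ℤ₃ 0ℓ
Σ₃ x = ∀ j → x j ≡ Fin.zero ⊎ x j ≡ Fin.suc Fin.zero

𝒞 : ℕ → Pred ℤ₃ 0ℓ
𝒞 M x = x ∈ Σ₃ × digit M *₃ x ∈ Σ₃

L : ℕ → ℕ
L k = (3 ℕ.^ k ∸ 1) / 2

-- The vertex v_N is represented by N, and a label in {0,1} by an
-- element of Fin 2.

data LabeledEdge (M : ℕ) : ℕ → Fin 2 → ℕ → Set where
  edge : ∀ N a →
         (toℕ a ℕ.+ N) % 3 ≡ 0 ⊎ (toℕ a ℕ.+ N) % 3 ≡ 1 →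
         LabeledEdge M N a ((N ℕ.+ M ℕ.* toℕ a) / 3)

Edge : ℕ → Rel ℕ 0ℓ
Edge M N N′ = ∃[ a ] LabeledEdge M N a N′

Vertex : ℕ → Pred ℕ 0ℓ
Vertex M N = Star (Edge M) 0 N

HasExactlyVertices : ℕ → ℕ → Set
HasExactlyVertices M k =
  Σ[ v ∈ (Fin k → ℕ) ]
    Injective _≡_ _≡_ v × (∀ N → N ∈ Vertex M ⇔ (∃[ i ] v i ≡ N))

-- All vertices on a path out of a vertex of the graph are again vertices
-- of the graph, so paths need not be restricted to Vertex M.

StronglyConnected : ℕ → Set
StronglyConnected M =
  ∀ i j → i ∈ Vertex M → j ∈ Vertex M → Star (Edge M) i j

-- The real numbers, characterised up to isomorphism as a Dedekind-complete
-- ordered field.  The value of _⁻¹ at 0# is irrelevant.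

record CompleteOrderedField : Set₁ where
  field
    commutativeRing : CommutativeRing 0ℓ 0ℓ

  open CommutativeRing commutativeRing public
    using (Carrier; _≈_; _≉_; _+_; _*_; -_; _-_; 0#; 1#)

  infix 4 _≤_
  infix 9 _⁻¹

  field
    _≤_          : Rel Carrier 0ℓ
    _⁻¹          : Carrier → Carrier
    0≉1          : 0# ≉ 1#
    ⁻¹-inverse   : ∀ x → x ≉ 0# → x * x ⁻¹ ≈ 1#
    isTotalOrder : IsTotalOrder _≈_ _≤_
    +-monoʳ-≤    : ∀ x {y z} → y ≤ z → x + y ≤ x + z
    *-nonNeg     : ∀ {x y} → 0# ≤ x → 0# ≤ y → 0# ≤ x * y

  IsLub : ∀ {ℓ} → Pred Carrier ℓ → Pred Carrier ℓ
  IsLub P s = (∀ x → P x → x ≤ s) × (∀ u → (∀ x → P x → x ≤ u) → s ≤ u)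

  IsGlb : ∀ {ℓ} → Pred Carrier ℓ → Pred Carrier ℓ
  IsGlb P s = (∀ x → P x → s ≤ x) × (∀ u → (∀ x → P x → u ≤ x) → u ≤ s)

  field
    complete : (P : Pred Carrier 0ℓ) → ∃ P →
               (∃[ u ] (∀ x → P x → x ≤ u)) → ∃ (IsLub P)

module Analysis (em : ExcludedMiddle (lsuc 0ℓ)) (R : CompleteOrderedField) where

  open CompleteOrderedField R public
  open Semiring (CommutativeRing.semiring commutativeRing) using (rawSemiring)
  open Algebra.Definitions.RawSemiring rawSemiring public
    using (_^_; sum) renaming (_×_ to _×ℕ_)

  infix 4 _<_
  _<_ : Rel Carrier 0ℓ
  x < y = x ≤ y × x ≉ y

  fromℕ : ℕ → Carrier
  fromℕ n = n ×ℕ 1#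

  infixl 7 _÷_
  _÷_ : Carrier → Carrier → Carrier
  x ÷ y = x * y ⁻¹

  Σ< : ℕ → (ℕ → Carrier) → Carrier
  Σ< n f = sum {n} (λ i → f (toℕ i))

  -- Definite description: a value satisfying P, with junk value 0# when
  -- there is none.  Every P used below has at most one solution up to _≈_
  -- in the range where it is meant to be used.

  the₁ : Pred Carrier (lsuc 0ℓ) → Carrier
  the₁ P with em {∃ P}
  ... | yes (x , _) = x
  ... | no  _       = 0#

  the : Pred Carrier 0ℓ → Carrier
  the P = the₁ (λ x → Lift (lsuc 0ℓ) (P x))

  -- y = b^s for b > 0, or for b = 0 and s > 0: y lies between the rational
  -- powers b^((m-n)/q) with (m-n)/q ≤ s and those with s ≤ (m-n)/q.  The
  -- inequalities are cleared of roots and denominators.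

  IsPow : Carrier → Carrier → Pred Carrier 0ℓ
  IsPow b s y = 0# ≤ y × (∀ m n q →
    (fromℕ m ≤ fromℕ n + fromℕ q * s →
       (1# ≤ b → b ^ m ≤ y ^ q * b ^ n) × (b ≤ 1# → y ^ q * b ^ n ≤ b ^ m)) ×
    (fromℕ n + fromℕ q * s ≤ fromℕ m →
       (1# ≤ b → y ^ q * b ^ n ≤ b ^ m) × (b ≤ 1# → b ^ m ≤ y ^ q * b ^ n)))

  pow : Carrier → Carrier → Carrier
  pow b s = the (IsPow b s)

  -- Meant for b > 1 and y > 0.

  log : Carrier → Carrier → Carrier
  log b y = the (λ t → IsPow b t y)

  e : Carrier
  e = the (IsLub (λ x → ∃[ n ] x ≈ Σ< n (λ j → fromℕ (j !) ⁻¹)))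

  ln : Carrier → Carrier
  ln = log e

  -- |x - y|₃ = 3^(-n), where n is the first index at which the digits of
  -- x and y differ.

  dist : ℤ₃ → ℤ₃ → Carrier
  dist x y = the λ r →
    ((∀ j → x j ≡ y j) → r ≈ 0#) ×
    (∀ n → (∀ j → j ℕ.< n → x j ≡ y j) → x n ≢ y n → r ≈ (fromℕ 3 ^ n) ⁻¹)

  -- Including 0# makes the diameter of the empty set 0.

  diam : Pred ℤ₃ 0ℓ → Carrier
  diam U = the (IsLub (λ r → r ≈ 0# ⊎
    (∃[ x ] ∃[ y ] (x ∈ U × y ∈ U × r ≈ dist x y))))

  -- The s-dimensional Hausdorff measure of E is 0.  A series of nonnegative
  -- terms has sum at most ε when all its partial sums do.

  HausdorffNull : Pred ℤ₃ 0ℓ → Carrier → Set₁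
  HausdorffNull E s =
    ∀ δ ε → 0# < δ → 0# < ε →
    Σ[ U ∈ (ℕ → Pred ℤ₃ 0ℓ) ]
      E ⊆ ⋃ ℕ U ×
      (∀ i → diam (U i) ≤ δ) ×
      (∀ n → Σ< n (λ i → pow (diam (U i)) s) ≤ ε)

  -- Restricting the infimum to s > 0 does not change it, because the null
  -- exponents are upward closed, and it avoids the convention for 0^0.

  dimH : Pred ℤ₃ 0ℓ → Carrier
  dimH E = the₁ (IsGlb (λ s → 0# < s × HausdorffNull E s))

  IsRoot>1 : ℕ → Pred Carrier 0ℓ
  IsRoot>1 k x = 1# < x × x ^ k - x ^ (k ∸ 1) - 1# ≈ 0#

  infix 4 ∣_∣≤_
  ∣_∣≤_ : Carrier → Carrier → Set
  ∣ x ∣≤ y = x ≤ y × - x ≤ y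

-- Multiplying a 0/1 digit sequence by L k = 1 + 3 + ⋯ + 3^(k-1) produces no
-- digit 2 exactly when, after each digit 1, the next k - 1 digits vanish: the
-- carry at a vertex is L j, where j counts the zeros still forced.  With h(j) = β^(-j), the
-- equation β^k = β^(k-1) + 1 says that h is a positive eigenvector of the
-- transfer matrix for β.  Hence at most β^(n+k-1) cylinders of length n cover
-- 𝒞, and there is a Markov measure giving mass at most β^(-n) to each of them.
-- Instead of integrating that measure over a cover, a point of 𝒞 is followed
-- digit by digit so that the pieces of the cover meeting the current cylinder
-- have at most half of its mass; such a point is in no piece.
--
-- For the asymptotics put δ = β - 1, so that β^(k-1) δ = 1.  Bernoulli-type
-- inequalities give β^(k-1) ≤ k, hence kδ ≤ 3 k log₃ β ≤ 3 (1 + log₃ k), and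
-- β^k lies between k / (6 log₃ k) and 3 k.
module Submission where

open import Defs
open import Level using (0ℓ; Lift; lift) renaming (suc to lsuc)
open import Algebra.Bundles using (CommutativeRing)
open import Axiom.ExcludedMiddle using (ExcludedMiddle)
open import Data.Empty using (⊥-elim)
open import Data.Fin.Base as Fin using (Fin; toℕ)
import Data.Fin.Properties as Fin
open import Data.List.Base using (List; []; _∷_; _++_; length; map)
import Data.List.Properties as List
open import Data.List.Relation.Unary.Any as Any using (Any; here; there)
import Data.List.Relation.Unary.Any.Properties as Any
open import Data.Maybe.Base using (Maybe; just; nothing)
open import Data.Nat.Base as ℕ using (ℕ; zero; suc; z≤n; s≤s; _!)
import Data.Nat.Properties as ℕ
open import Data.Product using (_×_; _,_; proj₁; proj₂; ∃; ∃!; ∃-syntax)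
open import Data.Sum.Base using (_⊎_; inj₁; inj₂; [_,_]′)
open import Function.Base using (_∘_)
open import Function.Bundles using (mk⇔)
open import Relation.Binary.Bundles using (Poset)
open import Relation.Binary.PropositionalEquality.Core as ≡ using (_≡_; _≢_)
open import Relation.Binary.Structures using (IsTotalOrder)
open import Relation.Nullary using (¬_; Dec; yes; no; contradiction)
open import Relation.Unary using (Pred; _∈_; _⊆_; ∅)

-- The reals are an arbitrary complete ordered field, and `pow`, `log` and `ln` are definite
-- descriptions by rational comparisons, so nothing is known about them beforehand. Everything is
-- reduced to one function `ℓ`, the logarithm to base 3 on the reals at least 1, built as a
-- supremum, and to its inverse `exp₃`. Diameters are 0 or 3^(-n), so with T = 3^s a cover is
-- measured by the integer powers T^(-n), which are compared with β^(-n). In the lower bound the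
-- cover is infinite and may contain sets of diameter 0, whose s-th power is 0. All pieces are first
-- enlarged to cylinders, at a cost bounded by a geometric series. Being at most half is inherited
-- because mass is additive: if the pieces took more than half of each child, they would take more
-- than half of the parent. A piece containing the current cylinder would take all of it, so none
-- ever does. Only partial sums occur, so neither the sum of a series nor compactness is used.

-- The graph of a repunit

module Automaton where

  open import Data.Nat.Base using (_+_; _*_; _∸_; _^_; _≤_; _<_; NonZero)
  open import Data.Nat.DivMod
  open import Data.Nat.Divisibility using (divides-refl)
  open import Data.Nat.Tactic.RingSolver using (solve-∀)
  open import Relation.Binary.PropositionalEquality using (refl; sym; trans; cong; cong₂; subst; module ≡-Reasoning)
  open import Relation.Binary.Construct.Closure.ReflexiveTransitive using (Star; ε; _◅_; _◅◅_)
  open ≡-Reasoning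

  [m+kn]/n≡m/n+k : ∀ m k n .{{_ : NonZero n}} → (m + k * n) / n ≡ m / n + k
  [m+kn]/n≡m/n+k m k n = trans (+-distrib-/-∣ʳ m (divides-refl k)) (cong (m / n +_) (m*n/n≡m k n))

  -- Horner form of `L`: residues and quotients modulo 3 are visible without `∸` and `/`.
  repunit : ℕ → ℕ
  repunit zero    = 0
  repunit (suc j) = 1 + repunit j * 3

  3^j≡1+2repunit : ∀ j → 3 ^ j ≡ suc (repunit j * 2)
  3^j≡1+2repunit zero    = refl
  3^j≡1+2repunit (suc j) = trans (cong (3 *_) (3^j≡1+2repunit j)) (identity (repunit j))
    where
    identity : ∀ r → 3 * suc (r * 2) ≡ suc ((1 + r * 3) * 2)
    identity = solve-∀

  L≡repunit : ∀ j → L j ≡ repunit j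
  L≡repunit j = trans (cong (λ p → (p ∸ 1) / 2) (3^j≡1+2repunit j)) (m*n/n≡m (repunit j) 2)

  L-suc : ∀ j → L (suc j) ≡ 1 + L j * 3
  L-suc j = trans (L≡repunit (suc j)) (cong (λ r → 1 + r * 3) (sym (L≡repunit j)))

  L-injective : ∀ i j → L i ≡ L j → i ≡ j
  L-injective zero    zero    eq = refl
  L-injective zero    (suc j) eq with () ← trans eq (L-suc j)
  L-injective (suc i) zero    eq with () ← trans (sym eq) (L-suc i)
  L-injective (suc i) (suc j) eq = cong suc (L-injective i j
    (ℕ.*-cancelʳ-≡ (L i) (L j) 3 (ℕ.suc-injective (trans (sym (L-suc i)) (trans eq (L-suc j))))))

  L-suc-% : ∀ a j → (a + L (suc j)) % 3 ≡ suc a % 3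
  L-suc-% a j = trans (cong (λ l → (a + l) % 3) (L-suc j))
    (trans (cong (_% 3) (ℕ.+-suc a (L j * 3))) ([m+kn]%n≡m%n (suc a) (L j) 3))

  L-suc-/ : ∀ j → L (suc j) / 3 ≡ L j
  L-suc-/ j = trans (cong (_/ 3) (L-suc j)) ([m+kn]/n≡m/n+k 1 (L j) 3)

  -- State j stands for the vertex L j of the graph of L (suc m).
  data Step (m : ℕ) : ℕ → ℕ → ℕ → Set where
    stay : Step m 0 0 0
    jump : Step m 0 1 m
    drop : ∀ {j} → Step m (suc j) 0 j

  Allowed : ℕ → Set
  Allowed r = r % 3 ≡ 0 ⊎ r % 3 ≡ 1

  next : ℕ → ℕ → ℕ → ℕ
  next m N a = (N + L (suc m) * a) / 3

  next-0 : ∀ m N → next m N 0 ≡ N / 3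
  next-0 m N = cong (_/ 3) (trans (cong (N +_) (ℕ.*-zeroʳ (L (suc m)))) (ℕ.+-identityʳ N))

  step-allowed : ∀ {m j a j′} → Step m j a j′ → Allowed (a + L j)
  step-allowed stay         = inj₁ refl
  step-allowed jump         = inj₂ refl
  step-allowed (drop {j})   = inj₂ (L-suc-% 0 j)

  step-next : ∀ {m j a j′} → Step m j a j′ → next m (L j) a ≡ L j′
  step-next {m} stay       = next-0 m 0
  step-next {m} jump       = trans (cong (_/ 3) (ℕ.*-identityʳ (L (suc m)))) (L-suc-/ m)
  step-next {m} (drop {j}) = trans (next-0 m (L (suc j))) (L-suc-/ j)

  -- Positive repunits are 1 modulo 3, so digit 1 there has residue 2; this single prohibition is
  -- what forces the zeros. At state 0 both digits pass.
  allowed-step : ∀ m j {a} → a < 2 → Allowed (a + L j) → ∃[ j′ ] Step m j a j′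
  allowed-step m zero    {zero}  _ _  = 0 , stay
  allowed-step m zero    {suc zero} _ _ = m , jump
  allowed-step m (suc j) {zero}  _ _  = j , drop
  allowed-step m (suc j) {suc zero} _ ok with trans (sym (L-suc-% 1 j)) (proj₂-of ok)
    where
    proj₂-of : Allowed (1 + L (suc j)) → (1 + L (suc j)) % 3 ≡ 0
    proj₂-of (inj₁ eq) = eq
    proj₂-of (inj₂ eq) with () ← trans (sym (L-suc-% 1 j)) eq
  ... | ()
  allowed-step m j {suc (suc a)} (s≤s (s≤s ())) _

  step-≤ : ∀ {m j a j′} → j ≤ m → Step m j a j′ → j′ ≤ m
  step-≤ j≤m stay = z≤n
  step-≤ j≤m jump = ℕ.≤-refl
  step-≤ j<m drop = ℕ.<⇒≤ j<m

  step⇒edge : ∀ m j j′ a → Step m j (toℕ a) j′ → Edge (L (suc m)) (L j) (L j′)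
  step⇒edge m j j′ a st = a , subst (LabeledEdge (L (suc m)) (L j) a) (step-next st) (edge (L j) a (step-allowed st))

  edge⇒step : ∀ m {N N′} j → N ≡ L j → Edge (L (suc m)) N N′ → ∃[ j′ ] ∃[ a ] (Step m j a j′ × N′ ≡ L j′)
  edge⇒step m j refl (a , edge _ _ ok) =
    let (j′ , st) = allowed-step m j (Fin.toℕ<n a) ok
    in j′ , toℕ a , st , step-next st

  descend : ∀ m i d → Star (Edge (L (suc m))) (L (d + i)) (L i)
  descend m i zero    = ε
  descend m i (suc d) = step⇒edge m (suc d + i) (d + i) Fin.zero drop ◅ descend m i d

  descend-to : ∀ m {i j} → i ≤ j → Star (Edge (L (suc m))) (L j) (L i)
  descend-to m {i} {j} i≤j = subst (λ j → Star (Edge (L (suc m))) (L j) (L i)) (ℕ.m∸n+n≡m i≤j) (descend m i (j ∸ i))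

  -- `jump` enters the chain at its top state `m`, from which every state is reached by dropping.
  -- Together with the descent to 0 this gives strong connectivity.
  reach : ∀ m {j} → j ≤ m → Star (Edge (L (suc m))) 0 (L j)
  reach m j≤m = step⇒edge m 0 m (Fin.suc Fin.zero) jump ◅ descend-to m j≤m

  star-repunit : ∀ m {N N′} j → j ≤ m → N ≡ L j → Star (Edge (L (suc m))) N N′ → ∃[ j′ ] (j′ ≤ m × N′ ≡ L j′)
  star-repunit m j j≤m eq ε = j , j≤m , eq
  star-repunit m j j≤m eq (e ◅ es) =
    let (j′ , _ , st , eq′) = edge⇒step m j eq e
    in star-repunit m j′ (step-≤ j≤m st) eq′ es

  vertices : ∀ m → HasExactlyVertices (L (suc m)) (suc m)
  vertices m = (λ i → L (toℕ i)) ,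
    (λ {i} {j} eq → Fin.toℕ-injective (L-injective (toℕ i) (toℕ j) eq)) ,
    λ N → mk⇔
      (λ path → let (j , j≤m , eq) = star-repunit m 0 z≤n refl path in
        Fin.fromℕ< (s≤s j≤m) , trans (cong L (Fin.toℕ-fromℕ< (s≤s j≤m))) (sym eq))
      (λ { (i , refl) → reach m (ℕ.≤-pred (Fin.toℕ<n i)) })

  stronglyConnected : ∀ m → StronglyConnected (L (suc m))
  stronglyConnected m N N′ path path′ with star-repunit m 0 z≤n refl path | star-repunit m 0 z≤n refl path′
  ... | i , _ , refl | j , j≤m , refl = descend-to m {0} {i} z≤n ◅◅ reach m j≤m

  -- Digits and carries of a product

  infixl 7 _/3^_
  _/3^_ : ℕ → ℕ → ℕ
  a /3^ n = _/_ a (3 ^ n) {{ℕ.m^n≢0 3 n}}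

  toℕ-digit : ∀ a n → toℕ (digit a n) ≡ a /3^ n % 3
  toℕ-digit a n = Fin.toℕ-fromℕ< (m%n<n (a /3^ n) 3)

  /-3^suc : ∀ a n → a /3^ suc n ≡ a /3^ n / 3
  /-3^suc a n = trans (/-congʳ {m = a} {{3^suc≢0}} {{3^n*3≢0}} (ℕ.*-comm 3 (3 ^ n)))
    (sym (m/n/o≡m/[n*o] a (3 ^ n) 3 {{3^n≢0}} {{_}} {{3^n*3≢0}}))
    where
    3^n≢0   = ℕ.m^n≢0 3 n
    3^suc≢0 = ℕ.m^n≢0 3 (suc n)
    3^n*3≢0 = ℕ.m*n≢0 (3 ^ n) 3 {{3^n≢0}}

  [m+k3ⁿ]/3ⁿ≡m/3ⁿ+k : ∀ m k n → (m + k * 3 ^ n) /3^ n ≡ m /3^ n + k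
  [m+k3ⁿ]/3ⁿ≡m/3ⁿ+k m k n = [m+kn]/n≡m/n+k m k (3 ^ n) {{ℕ.m^n≢0 3 n}}

  truncate-digit : ∀ a n → a ≡ truncate (digit a) n + (a /3^ n) * 3 ^ n
  truncate-digit a zero    = sym (trans (ℕ.*-identityʳ (a / 1)) (n/1≡n a))
  truncate-digit a (suc n) = begin
    a                                                      ≡⟨ truncate-digit a n ⟩
    t + q * 3 ^ n                                          ≡⟨ cong (λ q → t + q * 3 ^ n) (m≡m%n+[m/n]*n q 3) ⟩
    t + (q % 3 + q / 3 * 3) * 3 ^ n                        ≡⟨ identity t (q % 3) (q / 3) (3 ^ n) ⟩
    t + q % 3 * 3 ^ n + q / 3 * 3 ^ suc n                  ≡⟨ cong₂ (λ d r → t + d * 3 ^ n + r * 3 ^ suc n) (sym (toℕ-digit a n)) (sym (/-3^suc a n)) ⟩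
    t + toℕ (digit a n) * 3 ^ n + a /3^ suc n * 3 ^ suc n ∎
    where
    t = truncate (digit a) n
    q = a /3^ n

    identity : ∀ t r s p → t + (r + s * 3) * p ≡ t + r * p + s * (3 * p)
    identity = solve-∀

  -- The summand is a multiple of 3 times 3^n, so the quotient by 3^n moves by a multiple of 3. This
  -- lets `product-digit` replace the truncation of `digit M` by `M` itself.
  digit-periodic : ∀ a k n → (a + k * 3 ^ suc n) /3^ n % 3 ≡ a /3^ n % 3
  digit-periodic a k n = begin
    (a + k * (3 * 3 ^ n)) /3^ n % 3   ≡⟨ cong (λ b → (a + b) /3^ n % 3) (sym (ℕ.*-assoc k 3 (3 ^ n))) ⟩
    (a + k * 3 * 3 ^ n) /3^ n % 3     ≡⟨ cong (_% 3) ([m+k3ⁿ]/3ⁿ≡m/3ⁿ+k a (k * 3) n) ⟩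
    (a /3^ n + k * 3) % 3             ≡⟨ [m+kn]%n≡m%n (a /3^ n) k 3 ⟩
    a /3^ n % 3                       ∎

  -- The amount that multiplication by `M` hands on to position `n`. By `carry-suc` it obeys the
  -- rule for the edges of the graph, so along a path it is the number of the current vertex.
  carry : ℕ → ℤ₃ → ℕ → ℕ
  carry M x n = M * truncate x n /3^ n

  truncate-/ : ∀ M x n → M * truncate x (suc n) /3^ n ≡ carry M x n + M * toℕ (x n)
  truncate-/ M x n = trans (cong (_/3^ n) (identity M (truncate x n) (toℕ (x n)) (3 ^ n)))
    ([m+k3ⁿ]/3ⁿ≡m/3ⁿ+k (M * truncate x n) (M * toℕ (x n)) n)
    where
    identity : ∀ M t d p → M * (t + d * p) ≡ M * t + M * d * p
    identity = solve-∀

  carry-zero : ∀ M x → carry M x 0 ≡ 0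
  carry-zero M x = trans (n/1≡n (M * 0)) (ℕ.*-zeroʳ M)

  carry-suc : ∀ M x n → carry M x (suc n) ≡ (carry M x n + M * toℕ (x n)) / 3
  carry-suc M x n = trans (/-3^suc (M * truncate x (suc n)) n) (cong (_/ 3) (truncate-/ M x n))

  product-digit : ∀ M x n → toℕ ((digit M *₃ x) n) ≡ (carry M x n + M * toℕ (x n)) % 3
  product-digit M x n = begin
    toℕ ((digit M *₃ x) n)              ≡⟨ toℕ-digit (u * t) n ⟩
    u * t /3^ n % 3                   ≡⟨ digit-periodic (u * t) (q * t) n ⟨
    (u * t + q * t * 3 ^ suc n) /3^ n % 3 ≡⟨ cong (λ b → b /3^ n % 3) (identity u q t (3 ^ suc n)) ⟨
    (u + q * 3 ^ suc n) * t /3^ n % 3 ≡⟨ cong (λ M → M * t /3^ n % 3) (truncate-digit M (suc n)) ⟨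
    M * t /3^ n % 3                   ≡⟨ cong (_% 3) (truncate-/ M x n) ⟩
    (carry M x n + M * toℕ (x n)) % 3   ∎
    where
    u = truncate (digit M) (suc n)
    t = truncate x (suc n)
    q = M /3^ suc n

    identity : ∀ u q t p → (u + q * p) * t ≡ u * t + q * t * p
    identity = solve-∀

  -- `L (suc m)` is 1 modulo 3, so only digit plus carry matters, which is the quantity tested by
  -- `LabeledEdge`.
  product-digit-L : ∀ m x n → toℕ ((digit (L (suc m)) *₃ x) n) ≡ (toℕ (x n) + carry (L (suc m)) x n) % 3
  product-digit-L m x n = begin
    toℕ ((digit (L (suc m)) *₃ x) n)     ≡⟨ product-digit (L (suc m)) x n ⟩
    (c + L (suc m) * a) % 3              ≡⟨ cong (λ l → (c + l * a) % 3) (L-suc m) ⟩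
    (c + (1 + L m * 3) * a) % 3          ≡⟨ cong (_% 3) (identity c (L m) a) ⟩
    (a + c + L m * a * 3) % 3            ≡⟨ [m+kn]%n≡m%n (a + c) (L m * a) 3 ⟩
    (a + c) % 3                          ∎
    where
    c = carry (L (suc m)) x n
    a = toℕ (x n)

    identity : ∀ c l a → c + (1 + l * 3) * a ≡ a + c + l * a * 3
    identity = solve-∀

  IsPath : ℕ → ℤ₃ → (ℕ → ℕ) → Set
  IsPath m x σ = σ 0 ≡ 0 × (∀ n → Step m (σ n) (toℕ (x n)) (σ (suc n)))

  binary⇒toℕ : ∀ {d : Fin 3} → d ≡ Fin.zero ⊎ d ≡ Fin.suc Fin.zero → toℕ d ≡ 0 ⊎ toℕ d ≡ 1
  binary⇒toℕ (inj₁ refl) = inj₁ refl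
  binary⇒toℕ (inj₂ refl) = inj₂ refl

  toℕ⇒binary : ∀ {d : Fin 3} → toℕ d ≡ 0 ⊎ toℕ d ≡ 1 → d ≡ Fin.zero ⊎ d ≡ Fin.suc Fin.zero
  toℕ⇒binary (inj₁ eq) = inj₁ (Fin.toℕ-injective eq)
  toℕ⇒binary (inj₂ eq) = inj₂ (Fin.toℕ-injective eq)

  step-binary : ∀ {m j a j′} → Step m j a j′ → a ≡ 0 ⊎ a ≡ 1
  step-binary stay = inj₁ refl
  step-binary jump = inj₂ refl
  step-binary drop = inj₁ refl

  binary-< : ∀ {a} → a ≡ 0 ⊎ a ≡ 1 → a < 2
  binary-< (inj₁ refl) = s≤s z≤n
  binary-< (inj₂ refl) = s≤s (s≤s z≤n)

  path⇒𝒞 : ∀ {m x σ} → IsPath m x σ → x ∈ 𝒞 (L (suc m))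
  path⇒𝒞 {m} {x} {σ} (σ0≡0 , steps) =
    (λ n → toℕ⇒binary (step-binary (steps n))) ,
    (λ n → toℕ⇒binary (subst (λ r → r ≡ 0 ⊎ r ≡ 1)
      (sym (trans (product-digit-L m x n) (cong (λ c → (toℕ (x n) + c) % 3) (carry≡ n))))
      (step-allowed (steps n))))
    where
    carry≡ : ∀ n → carry (L (suc m)) x n ≡ L (σ n)
    carry≡ zero    = trans (carry-zero (L (suc m)) x) (cong L (sym σ0≡0))
    carry≡ (suc n) = trans (carry-suc (L (suc m)) x n)
      (trans (cong (λ c → next m c (toℕ (x n))) (carry≡ n)) (step-next (steps n)))

  𝒞⇒path : ∀ {m x} → x ∈ 𝒞 (L (suc m)) → ∃ (IsPath m x)
  𝒞⇒path {m} {x} (x∈Σ₃ , Mx∈Σ₃) = (λ n → proj₁ (state n)) , refl , λ n → proj₂ (step n (proj₁ (state n)) (proj₂ (state n)))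
    where
    step : ∀ n j → carry (L (suc m)) x n ≡ L j → ∃[ j′ ] Step m j (toℕ (x n)) j′
    step n j eq = allowed-step m j (binary-< (binary⇒toℕ (x∈Σ₃ n)))
      (subst (λ r → r ≡ 0 ⊎ r ≡ 1) (trans (product-digit-L m x n) (cong (λ c → (toℕ (x n) + c) % 3) eq))
        (binary⇒toℕ (Mx∈Σ₃ n)))

    state : ∀ n → ∃[ j ] carry (L (suc m)) x n ≡ L j
    state zero    = 0 , carry-zero (L (suc m)) x
    state (suc n) =
      let (j , eq)  = state n
          (j′ , st) = step n j eq
      in j′ , trans (carry-suc (L (suc m)) x n) (trans (cong (λ c → next m c (toℕ (x n))) eq) (step-next st))

-- Ordered fields, suprema and integer brackets

module OrderedField (em : ExcludedMiddle (lsuc 0ℓ)) (R : CompleteOrderedField) where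

  open Analysis em R public
  open CommutativeRing commutativeRing public
    using (refl; sym; trans; reflexive; semiring; commutativeSemiring; ring;
           +-cong; +-congˡ; +-congʳ; +-comm; +-assoc; +-identityˡ; +-identityʳ;
           -‿inverseˡ; -‿inverseʳ; -‿cong;
           *-cong; *-congˡ; *-congʳ; *-comm; *-assoc; *-identityˡ; *-identityʳ; zeroˡ; zeroʳ)
  open IsTotalOrder isTotalOrder public
    using (total; antisym; isPartialOrder)
    renaming (refl to ≤-refl; trans to ≤-trans; reflexive to ≤-reflexive)
  open import Algebra.Properties.CommutativeSemiring.Exp commutativeSemiring public
    using (^-congˡ; ^-homo-*; ^-assocʳ; ^-distrib-*)
  open import Algebra.Properties.Semiring.Mult semiring public
    using (×-homo-+; ×1-homo-*)
  open import Algebra.Properties.Ring ring public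
    using (-‿distribˡ-*; -‿involutive)
  open import Algebra.Solver.Ring.NaturalCoefficients.Default commutativeSemiring public
    using (solve; _:=_; _:+_; _:*_; con; Polynomial)

  poset : Poset 0ℓ 0ℓ 0ℓ
  poset = record { isPartialOrder = isPartialOrder }

  open import Relation.Binary.Reasoning.PartialOrder poset public

  numeral : ∀ {n} → ℕ → Polynomial n
  numeral zero    = con 0
  numeral (suc m) = con 1 :+ numeral m

  decide : (P : Set) → Dec P
  decide P with em {Lift (lsuc 0ℓ) P}
  ... | yes (lift p) = yes p
  ... | no ¬p        = no λ p → ¬p (lift p)

  <-or-≥ : ∀ x y → x < y ⊎ y ≤ x
  <-or-≥ x y with total x y
  ... | inj₂ y≤x = inj₂ y≤x
  ... | inj₁ x≤y with decide (x ≈ y)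
  ...   | yes x≈y = inj₂ (≤-reflexive (sym x≈y))
  ...   | no  x≉y = inj₁ (x≤y , x≉y)

  <⇒≱ : ∀ {x y} → x < y → ¬ (y ≤ x)
  <⇒≱ (x≤y , x≉y) y≤x = x≉y (antisym x≤y y≤x)

  ≮⇒≥ : ∀ {x y} → ¬ (x < y) → y ≤ x
  ≮⇒≥ {x} {y} x≮y = [ (λ x<y → contradiction x<y x≮y) , (λ y≤x → y≤x) ]′ (<-or-≥ x y)

  <⇒≤ : ∀ {x y} → x < y → x ≤ y
  <⇒≤ = proj₁

  <-≤-trans : ∀ {x y z} → x < y → y ≤ z → x < z
  <-≤-trans {x} {y} {z} x<y y≤z = begin-strict x <⟨ x<y ⟩ y ≤⟨ y≤z ⟩ z ∎

  ≤-<-trans : ∀ {x y z} → x ≤ y → y < z → x < z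
  ≤-<-trans {x} {y} {z} x≤y y<z = begin-strict x ≤⟨ x≤y ⟩ y <⟨ y<z ⟩ z ∎

  <-resp-≈ : ∀ {x x′ y y′} → x ≈ x′ → y ≈ y′ → x < y → x′ < y′
  <-resp-≈ x≈ y≈ x<y = ≤-<-trans (≤-reflexive (sym x≈)) (<-≤-trans x<y (≤-reflexive y≈))

  ≤-resp-≈ : ∀ {x x′ y y′} → x ≈ x′ → y ≈ y′ → x ≤ y → x′ ≤ y′
  ≤-resp-≈ x≈ y≈ x≤y = ≤-trans (≤-reflexive (sym x≈)) (≤-trans x≤y (≤-reflexive y≈))

  +-monoˡ-≤ : ∀ z {x y} → x ≤ y → x + z ≤ y + z
  +-monoˡ-≤ z {x} {y} x≤y = ≤-resp-≈ (+-comm z x) (+-comm z y) (+-monoʳ-≤ z x≤y)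

  +-mono-≤ : ∀ {x y u v} → x ≤ y → u ≤ v → x + u ≤ y + v
  +-mono-≤ {y = y} {u} x≤y u≤v = ≤-trans (+-monoˡ-≤ u x≤y) (+-monoʳ-≤ y u≤v)

  +-cancelʳ : ∀ {x y} z → x + z ≈ y + z → x ≈ y
  +-cancelʳ {x} {y} z eq = trans (sym (undo x)) (trans (+-congʳ eq) (undo y))
    where
    undo : ∀ w → w + z + - z ≈ w
    undo w = trans (+-assoc w z (- z)) (trans (+-congˡ (-‿inverseʳ z)) (+-identityʳ w))

  +-cancelʳ-≤ : ∀ {x y} z → x + z ≤ y + z → x ≤ y
  +-cancelʳ-≤ {x} {y} z le = ≤-resp-≈ (undo x) (undo y) (+-monoˡ-≤ (- z) le)
    where
    undo : ∀ w → w + z + - z ≈ w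
    undo w = trans (+-assoc w z (- z)) (trans (+-congˡ (-‿inverseʳ z)) (+-identityʳ w))

  +-mono-<-≤ : ∀ {x y u v} → x < y → u ≤ v → x + u < y + v
  +-mono-<-≤ {x} {y} {u} {v} x<y u≤v =
    +-mono-≤ (<⇒≤ x<y) u≤v ,
    λ eq → <⇒≱ x<y (+-cancelʳ-≤ u (≤-trans (+-monoʳ-≤ y u≤v) (≤-reflexive (sym eq))))

  -- y − x = b − a, with both sides moved so that the equation is a
  -- semiring identity.
  transfer-≤ : ∀ {a b x y} → a ≤ b → x + b ≈ y + a → x ≤ y
  transfer-≤ {a} {b} {x} {y} a≤b eq = +-cancelʳ-≤ b (≤-trans (≤-reflexive eq) (+-monoʳ-≤ y a≤b))

  transfer-< : ∀ {a b x y} → a < b → x + b ≈ y + a → x < y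
  transfer-< {a} {b} {x} {y} a<b eq =
    transfer-≤ (<⇒≤ a<b) eq ,
    λ x≈y → <⇒≱ a<b (+-cancelʳ-≤ y (≤-reflexive (trans (+-comm b y) (trans (+-congʳ (sym x≈y)) (trans eq (+-comm y a))))))

  x≤x+y : ∀ x {y} → 0# ≤ y → x ≤ x + y
  x≤x+y x {y} 0≤y = transfer-≤ 0≤y (sym (+-identityʳ (x + y)))

  x<x+y : ∀ x {y} → 0# < y → x < x + y
  x<x+y x {y} 0<y = transfer-< 0<y (sym (+-identityʳ (x + y)))

  0≤+ : ∀ {x y} → 0# ≤ x → 0# ≤ y → 0# ≤ x + y
  0≤+ {x} 0≤x 0≤y = ≤-trans 0≤x (x≤x+y x 0≤y)

  difference-≤ : ∀ {x y} → x ≤ y → ∃[ d ] (0# ≤ d × y ≈ x + d)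
  difference-≤ {x} {y} x≤y = y + - x ,
    ≤-resp-≈ (-‿inverseʳ x) refl (+-monoˡ-≤ (- x) x≤y) ,
    sym (trans (+-comm x (y + - x)) (trans (+-assoc y (- x) x) (trans (+-congˡ (-‿inverseˡ x)) (+-identityʳ y))))

  difference-< : ∀ {x y} → x < y → ∃[ d ] (0# < d × y ≈ x + d)
  difference-< {x} {y} x<y with difference-≤ (<⇒≤ x<y)
  ... | d , 0≤d , eq = d , (0≤d , λ 0≈d → proj₂ x<y (sym (trans eq (trans (+-congˡ (sym 0≈d)) (+-identityʳ x))))) , eq

  0≤1 : 0# ≤ 1#
  0≤1 with total 0# 1#
  ... | inj₁ 0≤1 = 0≤1
  ... | inj₂ 1≤0 = ≤-resp-≈ refl square (*-nonNeg 0≤-1 0≤-1)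
    where
    0≤-1 : 0# ≤ - 1#
    0≤-1 = ≤-resp-≈ (-‿inverseʳ 1#) (+-identityˡ (- 1#)) (+-monoˡ-≤ (- 1#) 1≤0)

    square : - 1# * - 1# ≈ 1#
    square = trans (sym (-‿distribˡ-* 1# (- 1#)))
      (trans (-‿cong (*-identityˡ (- 1#))) (-‿involutive 1#))

  0<1 : 0# < 1#
  0<1 = 0≤1 , 0≉1

  >⇒≉0 : ∀ {x} → 0# < x → x ≉ 0#
  >⇒≉0 0<x x≈0 = proj₂ 0<x (sym x≈0)

  *-monoˡ-≤ : ∀ {c x y} → 0# ≤ c → x ≤ y → c * x ≤ c * y
  *-monoˡ-≤ {c} {x} {y} 0≤c x≤y with difference-≤ x≤y
  ... | d , 0≤d , y≈x+d = transfer-≤ (*-nonNeg 0≤c 0≤d)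
    (trans (solve 3 (λ c x d → c :* x :+ c :* d := c :* (x :+ d) :+ con 0) refl c x d)
           (+-congʳ (*-congˡ (sym y≈x+d))))

  *-monoʳ-≤ : ∀ {c x y} → 0# ≤ c → x ≤ y → x * c ≤ y * c
  *-monoʳ-≤ {c} {x} {y} 0≤c x≤y = ≤-resp-≈ (*-comm c x) (*-comm c y) (*-monoˡ-≤ 0≤c x≤y)

  *-mono-≤ : ∀ {x y u v} → 0# ≤ x → 0# ≤ u → x ≤ y → u ≤ v → x * u ≤ y * v
  *-mono-≤ 0≤x 0≤u x≤y u≤v = ≤-trans (*-monoʳ-≤ 0≤u x≤y) (*-monoˡ-≤ (≤-trans 0≤x x≤y) u≤v)

  ⁻¹-cancel : ∀ {x} → 0# < x → ∀ y → x ⁻¹ * (x * y) ≈ y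
  ⁻¹-cancel {x} 0<x y = trans (sym (*-assoc (x ⁻¹) x y))
    (trans (*-congʳ (trans (*-comm (x ⁻¹) x) (⁻¹-inverse x (>⇒≉0 0<x)))) (*-identityˡ y))

  *-cancelˡ : ∀ {c x y} → 0# < c → c * x ≈ c * y → x ≈ y
  *-cancelˡ {c} {x} {y} 0<c eq = trans (sym (⁻¹-cancel 0<c x)) (trans (*-congˡ eq) (⁻¹-cancel 0<c y))

  0<* : ∀ {x y} → 0# < x → 0# < y → 0# < x * y
  0<* {x} {y} 0<x 0<y = *-nonNeg (<⇒≤ 0<x) (<⇒≤ 0<y) ,
    λ 0≈xy → proj₂ 0<y (*-cancelˡ 0<x (trans (zeroʳ x) 0≈xy))

  *-monoˡ-< : ∀ {c x y} → 0# < c → x < y → c * x < c * y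
  *-monoˡ-< 0<c x<y = *-monoˡ-≤ (<⇒≤ 0<c) (<⇒≤ x<y) , λ eq → proj₂ x<y (*-cancelˡ 0<c eq)

  *-cancelˡ-≤ : ∀ {c x y} → 0# < c → c * x ≤ c * y → x ≤ y
  *-cancelˡ-≤ 0<c le = ≮⇒≥ λ y<x → <⇒≱ (*-monoˡ-< 0<c y<x) le

  0<⁻¹ : ∀ {x} → 0# < x → 0# < x ⁻¹
  0<⁻¹ {x} 0<x with <-or-≥ 0# (x ⁻¹)
  ... | inj₁ 0<x⁻¹ = 0<x⁻¹
  ... | inj₂ x⁻¹≤0 = contradiction (≤-resp-≈ (⁻¹-inverse x (>⇒≉0 0<x)) (zeroʳ x) (*-monoˡ-≤ (<⇒≤ 0<x) x⁻¹≤0)) (<⇒≱ 0<1)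

  x*x⁻¹ : ∀ {x} → 0# < x → x * x ⁻¹ ≈ 1#
  x*x⁻¹ {x} 0<x = ⁻¹-inverse x (>⇒≉0 0<x)

  ÷-cancel : ∀ {c} x → 0# < c → c * (x ÷ c) ≈ x
  ÷-cancel {c} x 0<c = trans (solve 3 (λ c x i → c :* (x :* i) := c :* i :* x) refl c x (c ⁻¹))
    (trans (*-congʳ (x*x⁻¹ 0<c)) (*-identityˡ x))

  1≤⇒0< : ∀ {x} → 1# ≤ x → 0# < x
  1≤⇒0< = <-≤-trans 0<1

  1≤⇒0≤ : ∀ {x} → 1# ≤ x → 0# ≤ x
  1≤⇒0≤ = ≤-trans 0≤1

  1≤* : ∀ {x y} → 1# ≤ x → 1# ≤ y → 1# ≤ x * y
  1≤* 1≤x 1≤y = ≤-resp-≈ (*-identityˡ 1#) refl (*-mono-≤ 0≤1 0≤1 1≤x 1≤y)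

  -- Powers

  0≤^ : ∀ {x} n → 0# ≤ x → 0# ≤ x ^ n
  0≤^ zero    0≤x = 0≤1
  0≤^ (suc n) 0≤x = *-nonNeg 0≤x (0≤^ n 0≤x)

  0<^ : ∀ {x} n → 0# < x → 0# < x ^ n
  0<^ zero    0<x = 0<1
  0<^ (suc n) 0<x = 0<* 0<x (0<^ n 0<x)

  1≤^ : ∀ {x} n → 1# ≤ x → 1# ≤ x ^ n
  1≤^ zero    1≤x = ≤-refl
  1≤^ (suc n) 1≤x = 1≤* 1≤x (1≤^ n 1≤x)

  ^-monoˡ-≤ : ∀ {x y} n → 0# ≤ x → x ≤ y → x ^ n ≤ y ^ n
  ^-monoˡ-≤ zero    0≤x x≤y = ≤-refl
  ^-monoˡ-≤ (suc n) 0≤x x≤y = *-mono-≤ 0≤x (0≤^ n 0≤x) x≤y (^-monoˡ-≤ n 0≤x x≤y)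

  ^-monoʳ-≤ : ∀ {x m n} → 1# ≤ x → m ℕ.≤ n → x ^ m ≤ x ^ n
  ^-monoʳ-≤ {n = n} 1≤x z≤n     = 1≤^ n 1≤x
  ^-monoʳ-≤         1≤x (s≤s m≤n) = *-monoˡ-≤ (1≤⇒0≤ 1≤x) (^-monoʳ-≤ 1≤x m≤n)

  ^-monoʳ-< : ∀ {x m n} → 1# < x → m ℕ.< n → x ^ m < x ^ n
  ^-monoʳ-< {x} {m} {n} 1<x m<n = begin-strict
    x ^ m      ≈⟨ *-identityʳ (x ^ m) ⟨
    x ^ m * 1# <⟨ *-monoˡ-< (0<^ m (1≤⇒0< (<⇒≤ 1<x))) 1<x ⟩
    x ^ m * x  ≈⟨ *-comm (x ^ m) x ⟩
    x * x ^ m  ≤⟨ ^-monoʳ-≤ (<⇒≤ 1<x) m<n ⟩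
    x ^ n      ∎

  ^-cancelʳ-≤ : ∀ {x} m n → 1# < x → x ^ m ≤ x ^ n → m ℕ.≤ n
  ^-cancelʳ-≤ m n 1<x le = ℕ.≮⇒≥ λ n<m → <⇒≱ (^-monoʳ-< 1<x n<m) le

  1^n≈1 : ∀ n → 1# ^ n ≈ 1#
  1^n≈1 zero    = refl
  1^n≈1 (suc n) = trans (*-identityˡ _) (1^n≈1 n)

  ^-≤1 : ∀ {x} n → 0# ≤ x → x ≤ 1# → x ^ n ≤ 1#
  ^-≤1 n 0≤x x≤1 = ≤-resp-≈ refl (1^n≈1 n) (^-monoˡ-≤ n 0≤x x≤1)

  -- Natural numbers

  fromℕ-+ : ∀ m n → fromℕ (m ℕ.+ n) ≈ fromℕ m + fromℕ n
  fromℕ-+ = ×-homo-+ 1#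

  fromℕ-* : ∀ m n → fromℕ (m ℕ.* n) ≈ fromℕ m * fromℕ n
  fromℕ-* = ×1-homo-*

  0≤fromℕ : ∀ n → 0# ≤ fromℕ n
  0≤fromℕ zero    = ≤-refl
  0≤fromℕ (suc n) = 0≤+ 0≤1 (0≤fromℕ n)

  fromℕ-mono-≤ : ∀ {m n} → m ℕ.≤ n → fromℕ m ≤ fromℕ n
  fromℕ-mono-≤ {n = n} z≤n = 0≤fromℕ n
  fromℕ-mono-≤ (s≤s m≤n)   = +-monoʳ-≤ 1# (fromℕ-mono-≤ m≤n)

  fromℕ1≈1 : fromℕ 1 ≈ 1#
  fromℕ1≈1 = +-identityʳ 1#

  1≤fromℕ-suc : ∀ n → 1# ≤ fromℕ (suc n)
  1≤fromℕ-suc n = x≤x+y 1# (0≤fromℕ n)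

  0<fromℕ-suc : ∀ n → 0# < fromℕ (suc n)
  0<fromℕ-suc n = 1≤⇒0< (1≤fromℕ-suc n)

  fromℕ<fromℕ-suc : ∀ n → fromℕ n < fromℕ (suc n)
  fromℕ<fromℕ-suc n = transfer-< 0<1 (solve 1 (λ n → n :+ con 1 := con 1 :+ n :+ con 0) refl (fromℕ n))

  fromℕ-mono-< : ∀ {m n} → m ℕ.< n → fromℕ m < fromℕ n
  fromℕ-mono-< {m} m<n = <-≤-trans (fromℕ<fromℕ-suc m) (fromℕ-mono-≤ m<n)

  -- Completeness

  the₁-spec : ∀ {P : Pred Carrier (lsuc 0ℓ)} → ∃ P → P (the₁ P)
  the₁-spec {P} p with em {∃ P}
  ... | yes (_ , px) = px
  ... | no ¬p        = contradiction p ¬p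

  the-spec : ∀ {P : Pred Carrier 0ℓ} → ∃ P → P (the P)
  the-spec {P} (x , px) = Level.lower (the₁-spec {λ x → Lift (lsuc 0ℓ) (P x)} (x , lift px))

  lub-unique : ∀ {P : Pred Carrier 0ℓ} {x y} → IsLub P x → IsLub P y → x ≈ y
  lub-unique (ub , least) (ub′ , least′) = antisym (least _ ub′) (least′ _ ub)

  lub-approx : ∀ {P : Pred Carrier 0ℓ} {s x} → IsLub P s → x < s → ∃[ y ] (P y × x < y)
  lub-approx {P} {s} {x} (_ , least) x<s with decide (∃[ y ] (P y × x < y))
  ... | yes found = found
  ... | no ¬found = contradiction (least x λ y py → ≮⇒≥ λ x<y → ¬found (y , py , x<y)) (<⇒≱ x<s)

  -- If the naturals were bounded, their supremum less 1 would also bound them, because n + 1 is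
  -- again a natural.
  archimedean : ∀ x → ∃[ n ] x < fromℕ n
  archimedean x with decide (∃[ n ] x < fromℕ n)
  ... | yes found = found
  ... | no ¬found = ⊥-elim (<⇒≱ s-1<s (proj₂ s-lub s-1 below))
    where
    IsNat : Pred Carrier 0ℓ
    IsNat y = ∃[ n ] y ≈ fromℕ n

    sup : ∃ (IsLub IsNat)
    sup = complete IsNat (0# , 0 , refl)
      (x , λ { y (n , y≈n) → ≤-trans (≤-reflexive y≈n) (≮⇒≥ λ x<n → ¬found (n , x<n)) })

    s s-1 : Carrier
    s   = proj₁ sup
    s-1 = s + - 1#

    s-lub : IsLub IsNat s
    s-lub = proj₂ sup

    s-1+1 : s-1 + 1# ≈ s
    s-1+1 = trans (+-assoc s (- 1#) 1#) (trans (+-congˡ (-‿inverseˡ 1#)) (+-identityʳ s))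

    s-1<s : s-1 < s
    s-1<s = transfer-< 0<1 (trans s-1+1 (sym (+-identityʳ s)))

    below : ∀ y → IsNat y → y ≤ s-1
    below y (n , y≈n) = ≤-trans (≤-reflexive y≈n) (+-cancelʳ-≤ 1#
      (≤-trans (≤-reflexive (+-comm (fromℕ n) 1#))
        (≤-trans (proj₁ s-lub _ (suc n , refl)) (≤-reflexive (sym s-1+1)))))

  bounded-multiples⇒≤0 : ∀ {x c} → (∀ q → fromℕ (suc q) * x ≤ c) → x ≤ 0#
  bounded-multiples⇒≤0 {x} {c} bounded = ≮⇒≥ λ 0<x →
    let (q , c/x<q) = archimedean (c ÷ x)
    in <⇒≱ (begin-strict
         c              ≈⟨ ÷-cancel c 0<x ⟨
         x * (c ÷ x)    <⟨ *-monoˡ-< 0<x c/x<q ⟩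
         x * fromℕ q    ≤⟨ *-monoˡ-≤ (<⇒≤ 0<x) (<⇒≤ (fromℕ<fromℕ-suc q)) ⟩
         x * fromℕ (suc q) ≈⟨ *-comm x (fromℕ (suc q)) ⟩
         fromℕ (suc q) * x ∎)
       (bounded q)

  -- The error `c` does not grow with `q`, so it disappears after division by `q`. This removes the
  -- rounding errors of integer brackets.
  ≤-by-multiples : ∀ {x y c} → (∀ q → fromℕ (suc q) * x ≤ fromℕ (suc q) * y + c) → x ≤ y
  ≤-by-multiples {x} {y} {c} bounded = ≮⇒≥ λ y<x →
    let (d , 0<d , x≈y+d) = difference-< y<x
    in <⇒≱ 0<d (bounded-multiples⇒≤0 {d} {c} λ q → transfer-≤ (bounded q)
         (trans (solve 4 (λ q d y c → q :* d :+ (q :* y :+ c) := c :+ q :* (y :+ d)) refl (fromℕ (suc q)) d y c)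
                (+-congˡ (*-congˡ (sym x≈y+d)))))

  last-below : ∀ (P : ℕ → Set) → P 0 → ∀ n → ¬ P n → ∃[ m ] (P m × ¬ P (suc m))
  last-below P p0 zero    ¬pn = contradiction p0 ¬pn
  last-below P p0 (suc n) ¬pn with decide (P n)
  ... | yes pn = n , pn , ¬pn
  ... | no ¬pn = last-below P p0 n ¬pn

  floor : ∀ {x} → 0# ≤ x → ∃[ a ] (fromℕ a ≤ x × x < fromℕ (suc a))
  floor {x} 0≤x =
    let (n , x<n)           = archimedean x
        (a , a≤x , ¬a+1≤x) = last-below (λ m → fromℕ m ≤ x) 0≤x n (<⇒≱ x<n)
    in a , a≤x , [ (λ lt → lt) , (λ le → contradiction le ¬a+1≤x) ]′ (<-or-≥ x (fromℕ (suc a)))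

  bernoulli : ∀ {h} n → 0# ≤ h → 1# + fromℕ n * h ≤ (1# + h) ^ n
  bernoulli {h} zero    0≤h = ≤-reflexive (solve 1 (λ h → con 1 :+ con 0 :* h := con 1) refl h)
  bernoulli {h} (suc n) 0≤h = begin
    1# + fromℕ (suc n) * h              ≤⟨ x≤x+y _ (*-nonNeg (*-nonNeg (0≤fromℕ n) 0≤h) 0≤h) ⟩
    1# + fromℕ (suc n) * h + fromℕ n * h * h
      ≈⟨ solve 2 (λ h n → con 1 :+ (con 1 :+ n) :* h :+ n :* h :* h := (con 1 :+ h) :* (con 1 :+ n :* h)) refl h (fromℕ n) ⟩
    (1# + h) * (1# + fromℕ n * h)       ≤⟨ *-monoˡ-≤ (0≤+ 0≤1 0≤h) (bernoulli n 0≤h) ⟩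
    (1# + h) * (1# + h) ^ n             ∎

  ^-unbounded : ∀ {b} → 1# < b → ∀ c → ∃[ n ] (∀ m → n ℕ.≤ m → c < b ^ m)
  ^-unbounded {b} 1<b c with difference-< 1<b
  ... | h , 0<h , b≈1+h with archimedean (c ÷ h)
  ... | n , c/h<n = n , λ m n≤m → begin-strict
    c                ≈⟨ ÷-cancel c 0<h ⟨
    h * (c ÷ h)      <⟨ *-monoˡ-< 0<h c/h<n ⟩
    h * fromℕ n      ≈⟨ trans (*-comm h (fromℕ n)) (sym (+-identityˡ _)) ⟩
    0# + fromℕ n * h ≤⟨ +-monoˡ-≤ _ 0≤1 ⟩
    1# + fromℕ n * h ≤⟨ bernoulli n (<⇒≤ 0<h) ⟩
    (1# + h) ^ n     ≈⟨ ^-congˡ n b≈1+h ⟨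
    b ^ n            ≤⟨ ^-monoʳ-≤ (<⇒≤ 1<b) n≤m ⟩
    b ^ m            ∎

  ^-bracket : ∀ {b y} → 1# < b → 1# ≤ y → ∃[ a ] (b ^ a ≤ y × y < b ^ suc a)
  ^-bracket {b} {y} 1<b 1≤y =
    let (n , y<bⁿ)        = ^-unbounded 1<b y
        (a , bᵃ≤y , ¬le) = last-below (λ m → b ^ m ≤ y) 1≤y n (<⇒≱ (y<bⁿ n ℕ.≤-refl))
    in a , bᵃ≤y , [ (λ lt → lt) , (λ le → contradiction le ¬le) ]′ (<-or-≥ y (b ^ suc a))

  -- Multiplicative counterpart of `≤-by-multiples`: if x > y, the powers of x / y outgrow the
  -- constant `c`.
  ≤-by-powers : ∀ {x y c} → 0# < y → 0# ≤ x → (∀ q → x ^ q ≤ c * y ^ q) → x ≤ y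
  ≤-by-powers {x} {y} {c} 0<y 0≤x bounded = ≮⇒≥ λ y<x →
    let u         = x ÷ y
        yu≈x      = ÷-cancel x 0<y
        1<u       = [ (λ lt → lt) , (λ u≤1 → contradiction
                      (≤-resp-≈ yu≈x (*-identityʳ y) (*-monoˡ-≤ (<⇒≤ 0<y) u≤1)) (<⇒≱ y<x)) ]′ (<-or-≥ 1# u)
        (q , big) = ^-unbounded 1<u c
    in <⇒≱ (begin-strict
         c * y ^ q     ≈⟨ *-comm c (y ^ q) ⟩
         y ^ q * c     <⟨ *-monoˡ-< (0<^ q 0<y) (big q ℕ.≤-refl) ⟩
         y ^ q * u ^ q ≈⟨ ^-distrib-* y u q ⟨
         (y * u) ^ q   ≈⟨ ^-congˡ q yu≈x ⟩
         x ^ q         ∎)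
       (bounded q)

-- Logarithms, and powers with real exponent

module Logarithm (em : ExcludedMiddle (lsuc 0ℓ)) (R : CompleteOrderedField) where

  open OrderedField em R

  three : Carrier
  three = fromℕ 3

  1<3 : 1# < three
  1<3 = ≤-<-trans (≤-reflexive (sym fromℕ1≈1)) (fromℕ-mono-< {1} {3} (s≤s (s≤s z≤n)))

  0<3 : 0# < three
  0<3 = 1≤⇒0< (<⇒≤ 1<3)

  -- Lower Dedekind cut of log₃ y for y ≥ 1: everything up to a fraction m / (p + 1) with 3^m ≤
  -- y^(p+1).
  LogCut : Carrier → Pred Carrier 0ℓ
  LogCut y x = ∃[ m ] ∃[ p ] (fromℕ (suc p) * x ≤ fromℕ m × three ^ m ≤ y ^ suc p)

  -- Fractions are compared through a common exponent: 3^(m′(p+1)) ≤ y^((p+1)(p′+1)) ≤ 3^(m(p′+1)),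
  -- and powers of 3 reflect the order of their exponents.
  LogCut-bound : ∀ {y} m p → 1# ≤ y → y ^ suc p ≤ three ^ m →
                 ∀ x → LogCut y x → fromℕ (suc p) * x ≤ fromℕ m
  LogCut-bound {y} m p 1≤y y^q≤3^m x (m′ , p′ , q′x≤m′ , 3^m′≤y^q′) = *-cancelˡ-≤ (0<fromℕ-suc p′) (begin
    q′ * (q * x)            ≈⟨ solve 3 (λ q′ q x → q′ :* (q :* x) := q :* (q′ :* x)) refl q′ q x ⟩
    q * (q′ * x)            ≤⟨ *-monoˡ-≤ (0≤fromℕ (suc p)) q′x≤m′ ⟩
    q * fromℕ m′            ≈⟨ *-comm q (fromℕ m′) ⟩
    fromℕ m′ * q            ≈⟨ fromℕ-* m′ (suc p) ⟨
    fromℕ (m′ ℕ.* suc p)    ≤⟨ fromℕ-mono-≤ (^-cancelʳ-≤ (m′ ℕ.* suc p) (m ℕ.* suc p′) 1<3 powers) ⟩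
    fromℕ (m ℕ.* suc p′)    ≈⟨ fromℕ-* m (suc p′) ⟩
    fromℕ m * q′            ≈⟨ *-comm (fromℕ m) q′ ⟩
    q′ * fromℕ m            ∎)
    where
    q  = fromℕ (suc p)
    q′ = fromℕ (suc p′)

    powers : three ^ (m′ ℕ.* suc p) ≤ three ^ (m ℕ.* suc p′)
    powers = begin
      three ^ (m′ ℕ.* suc p)   ≈⟨ ^-assocʳ three m′ (suc p) ⟨
      (three ^ m′) ^ suc p     ≤⟨ ^-monoˡ-≤ (suc p) (0≤^ m′ (<⇒≤ 0<3)) 3^m′≤y^q′ ⟩
      (y ^ suc p′) ^ suc p     ≈⟨ ^-assocʳ y (suc p′) (suc p) ⟩
      y ^ (suc p′ ℕ.* suc p)   ≡⟨ ≡.cong (y ^_) (ℕ.*-comm (suc p′) (suc p)) ⟩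
      y ^ (suc p ℕ.* suc p′)   ≈⟨ ^-assocʳ y (suc p) (suc p′) ⟨
      (y ^ suc p) ^ suc p′     ≤⟨ ^-monoˡ-≤ (suc p′) (0≤^ (suc p) (1≤⇒0≤ 1≤y)) y^q≤3^m ⟩
      (three ^ m) ^ suc p′     ≈⟨ ^-assocʳ three m (suc p′) ⟩
      three ^ (m ℕ.* suc p′)   ∎

  LogCut-lub : ∀ {y} → 1# ≤ y → ∃ (IsLub (LogCut y))
  LogCut-lub {y} 1≤y =
    let (a , _ , y<3^a+1) = ^-bracket 1<3 1≤y
    in complete (LogCut y)
      (0# , 0 , 0 , ≤-reflexive (zeroʳ _) , 1≤^ 1 1≤y)
      (fromℕ (suc a) , λ x x∈ → ≤-resp-≈ (trans (*-congʳ fromℕ1≈1) (*-identityˡ x)) refl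
        (LogCut-bound (suc a) 0 1≤y (≤-trans (≤-reflexive (*-identityʳ y)) (<⇒≤ y<3^a+1)) x x∈))

  abstract
    -- The logarithm to base 3, meant for arguments at least 1. Outside this block it is known only
    -- through `ℓ-lub`.
    ℓ : Carrier → Carrier
    ℓ y = the (IsLub (LogCut y))

    ℓ-lub : ∀ {y} → 1# ≤ y → IsLub (LogCut y) (ℓ y)
    ℓ-lub {y} 1≤y = the-spec {IsLub (LogCut y)} (LogCut-lub 1≤y)

  ℓ-lower : ∀ {y} m p → 1# ≤ y → three ^ m ≤ y ^ suc p → fromℕ m ≤ fromℕ (suc p) * ℓ y
  ℓ-lower {y} m p 1≤y le = begin
    fromℕ m                                 ≈⟨ ÷-cancel (fromℕ m) (0<fromℕ-suc p) ⟨
    fromℕ (suc p) * (fromℕ m ÷ fromℕ (suc p)) ≤⟨ *-monoˡ-≤ (0≤fromℕ (suc p)) (proj₁ (ℓ-lub 1≤y) _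
       (m , p , ≤-reflexive (÷-cancel (fromℕ m) (0<fromℕ-suc p)) , le)) ⟩
    fromℕ (suc p) * ℓ y                     ∎

  ℓ-upper : ∀ {y} m p → 1# ≤ y → y ^ suc p ≤ three ^ m → fromℕ (suc p) * ℓ y ≤ fromℕ m
  ℓ-upper {y} m p 1≤y le = ≤-resp-≈ refl (÷-cancel (fromℕ m) 0<q) (*-monoˡ-≤ (<⇒≤ 0<q)
    (proj₂ (ℓ-lub 1≤y) (fromℕ m ÷ fromℕ (suc p)) λ x x∈ →
      *-cancelˡ-≤ 0<q (≤-trans (LogCut-bound m p 1≤y le x x∈) (≤-reflexive (sym (÷-cancel (fromℕ m) 0<q))))))
    where
    0<q = 0<fromℕ-suc p

  ℓ-mono : ∀ {y z} → 1# ≤ y → y ≤ z → ℓ y ≤ ℓ z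
  ℓ-mono {y} {z} 1≤y y≤z = proj₂ (ℓ-lub 1≤y) (ℓ z) λ { x (m , p , qx≤m , 3^m≤y^q) →
    proj₁ (ℓ-lub (≤-trans 1≤y y≤z)) x (m , p , qx≤m , ≤-trans 3^m≤y^q (^-monoˡ-≤ (suc p) (1≤⇒0≤ 1≤y) y≤z)) }

  ℓ-cong : ∀ {y z} → 1# ≤ y → y ≈ z → ℓ y ≈ ℓ z
  ℓ-cong 1≤y y≈z = antisym (ℓ-mono 1≤y (≤-reflexive y≈z))
    (ℓ-mono (≤-trans 1≤y (≤-reflexive y≈z)) (≤-reflexive (sym y≈z)))

  ℓ-3 : ℓ three ≈ 1#
  ℓ-3 = antisym
    (≤-resp-≈ (trans (*-congʳ fromℕ1≈1) (*-identityˡ _)) fromℕ1≈1 (ℓ-upper 1 0 (<⇒≤ 1<3) ≤-refl))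
    (≤-resp-≈ fromℕ1≈1 (trans (*-congʳ fromℕ1≈1) (*-identityˡ _)) (ℓ-lower 1 0 (<⇒≤ 1<3) ≤-refl))

  -- Bracketing y^q and z^q between consecutive powers of 3 determines q ℓ y and q ℓ z up to 1 each,
  -- hence the error 2 for every q.
  ℓ-* : ∀ {y z} → 1# ≤ y → 1# ≤ z → ℓ (y * z) ≈ ℓ y + ℓ z
  ℓ-* {y} {z} 1≤y 1≤z = antisym (≤-by-multiples {c = fromℕ 2} upper) (≤-by-multiples {c = fromℕ 2} lower)
    where
    1≤yz = 1≤* 1≤y 1≤z

    module _ (p : ℕ) where
      q = fromℕ (suc p)
      bracket-y = ^-bracket 1<3 (1≤^ (suc p) 1≤y)
      bracket-z = ^-bracket 1<3 (1≤^ (suc p) 1≤z)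
      a = proj₁ bracket-y
      b = proj₁ bracket-z

      upper : q * ℓ (y * z) ≤ q * (ℓ y + ℓ z) + fromℕ 2
      upper = begin
        q * ℓ (y * z)              ≤⟨ ℓ-upper (suc a ℕ.+ suc b) p 1≤yz (begin
          (y * z) ^ suc p              ≈⟨ ^-distrib-* y z (suc p) ⟩
          y ^ suc p * z ^ suc p        ≤⟨ *-mono-≤ (0≤^ (suc p) (1≤⇒0≤ 1≤y)) (0≤^ (suc p) (1≤⇒0≤ 1≤z))
                                            (<⇒≤ (proj₂ (proj₂ bracket-y))) (<⇒≤ (proj₂ (proj₂ bracket-z))) ⟩
          three ^ suc a * three ^ suc b ≈⟨ ^-homo-* three (suc a) (suc b) ⟨
          three ^ (suc a ℕ.+ suc b)    ∎) ⟩
        fromℕ (suc a ℕ.+ suc b)    ≈⟨ fromℕ-+ (suc a) (suc b) ⟩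
        (1# + fromℕ a) + (1# + fromℕ b) ≤⟨ +-mono-≤ (+-monoʳ-≤ 1# (ℓ-lower a p 1≤y (proj₁ (proj₂ bracket-y))))
                                                    (+-monoʳ-≤ 1# (ℓ-lower b p 1≤z (proj₁ (proj₂ bracket-z)))) ⟩
        (1# + q * ℓ y) + (1# + q * ℓ z) ≈⟨ solve 3 (λ q u v → (con 1 :+ q :* u) :+ (con 1 :+ q :* v)
                                             := q :* (u :+ v) :+ numeral 2) refl q (ℓ y) (ℓ z) ⟩
        q * (ℓ y + ℓ z) + fromℕ 2  ∎

      lower : q * (ℓ y + ℓ z) ≤ q * ℓ (y * z) + fromℕ 2
      lower = begin
        q * (ℓ y + ℓ z)              ≈⟨ solve 3 (λ q u v → q :* (u :+ v) := q :* u :+ q :* v) refl q (ℓ y) (ℓ z) ⟩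
        q * ℓ y + q * ℓ z            ≤⟨ +-mono-≤ (ℓ-upper (suc a) p 1≤y (<⇒≤ (proj₂ (proj₂ bracket-y))))
                                                 (ℓ-upper (suc b) p 1≤z (<⇒≤ (proj₂ (proj₂ bracket-z)))) ⟩
        (1# + fromℕ a) + (1# + fromℕ b) ≈⟨ solve 2 (λ a b → (con 1 :+ a) :+ (con 1 :+ b) := (a :+ b) :+ numeral 2) refl (fromℕ a) (fromℕ b) ⟩
        (fromℕ a + fromℕ b) + fromℕ 2 ≈⟨ +-congʳ (fromℕ-+ a b) ⟨
        fromℕ (a ℕ.+ b) + fromℕ 2    ≤⟨ +-monoˡ-≤ _ (ℓ-lower (a ℕ.+ b) p 1≤yz (begin
          three ^ (a ℕ.+ b)            ≈⟨ ^-homo-* three a b ⟩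
          three ^ a * three ^ b        ≤⟨ *-mono-≤ (0≤^ a (<⇒≤ 0<3)) (0≤^ b (<⇒≤ 0<3)) (proj₁ (proj₂ bracket-y)) (proj₁ (proj₂ bracket-z)) ⟩
          y ^ suc p * z ^ suc p        ≈⟨ ^-distrib-* y z (suc p) ⟨
          (y * z) ^ suc p              ∎)) ⟩
        q * ℓ (y * z) + fromℕ 2      ∎

  ℓ-1 : ℓ 1# ≈ 0#
  ℓ-1 = +-cancelʳ (ℓ 1#) (trans (sym (ℓ-* ≤-refl ≤-refl))
    (trans (ℓ-cong (1≤* ≤-refl ≤-refl) (*-identityˡ 1#)) (sym (+-identityˡ _))))

  0≤ℓ : ∀ {y} → 1# ≤ y → 0# ≤ ℓ y
  0≤ℓ 1≤y = ≤-trans (≤-reflexive (sym ℓ-1)) (ℓ-mono ≤-refl 1≤y)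

  ℓ-^ : ∀ {y} n → 1# ≤ y → ℓ (y ^ n) ≈ fromℕ n * ℓ y
  ℓ-^ {y} zero    1≤y = trans ℓ-1 (sym (zeroˡ _))
  ℓ-^ {y} (suc n) 1≤y = trans (ℓ-* 1≤y (1≤^ n 1≤y)) (trans (+-congˡ (ℓ-^ n 1≤y))
    (solve 2 (λ l n → l :+ n :* l := (con 1 :+ n) :* l) refl (ℓ y) (fromℕ n)))

  -- Some power of `y` exceeds 3, so `ℓ y` is at least the reciprocal of its exponent.
  0<ℓ : ∀ {y} → 1# < y → 0# < ℓ y
  0<ℓ {y} 1<y = let (n , 3<y^) = ^-unbounded 1<y three in [ (λ lt → lt) , (λ ℓ≤0 → contradiction
      (≤-trans (ℓ-lower 1 n (<⇒≤ 1<y) (≤-trans (≤-reflexive (*-identityʳ three)) (<⇒≤ (3<y^ (suc n) (ℕ.n≤1+n n)))))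
        (≤-resp-≈ refl (zeroʳ (fromℕ (suc n))) (*-monoˡ-≤ (0≤fromℕ (suc n)) ℓ≤0)))
      (<⇒≱ (0<fromℕ-suc 0))) ]′ (<-or-≥ 0# (ℓ y))

  quotient : ∀ {y z} → 1# ≤ y → y < z → ∃[ u ] (1# < u × y * u ≈ z)
  quotient {y} {z} 1≤y y<z = z ÷ y ,
    [ (λ lt → lt) , (λ u≤1 → contradiction
       (≤-resp-≈ eq (*-identityʳ y) (*-monoˡ-≤ (1≤⇒0≤ 1≤y) u≤1)) (<⇒≱ y<z)) ]′ (<-or-≥ 1# (z ÷ y)) ,
    eq
    where
    eq = ÷-cancel z (1≤⇒0< 1≤y)

  ℓ-mono-< : ∀ {y z} → 1# ≤ y → y < z → ℓ y < ℓ z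
  ℓ-mono-< {y} {z} 1≤y y<z = let (u , 1<u , yu≈z) = quotient 1≤y y<z in <-resp-≈ refl
    (trans (sym (ℓ-* 1≤y (<⇒≤ 1<u))) (ℓ-cong (1≤* 1≤y (<⇒≤ 1<u)) yu≈z)) (x<x+y (ℓ y) (0<ℓ 1<u))

  ℓ-cancel-≤ : ∀ {y z} → 1# ≤ z → ℓ y ≤ ℓ z → y ≤ z
  ℓ-cancel-≤ 1≤z le = ≮⇒≥ λ z<y → <⇒≱ (ℓ-mono-< 1≤z z<y) le

  -- The logarithm to an arbitrary base

  ℓ-monomial : ∀ {b y} q n → 1# ≤ b → 1# ≤ y → ℓ (y ^ q * b ^ n) ≈ fromℕ q * ℓ y + fromℕ n * ℓ b
  ℓ-monomial q n 1≤b 1≤y = trans (ℓ-* (1≤^ q 1≤y) (1≤^ n 1≤b)) (+-cong (ℓ-^ q 1≤y) (ℓ-^ n 1≤b))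

  IsPow-intro : ∀ {b t y} → 1# < b → 1# ≤ y → t * ℓ b ≈ ℓ y → IsPow b t y
  IsPow-intro {b} {t} {y} 1<b 1≤y tℓb≈ℓy = 1≤⇒0≤ 1≤y , λ m n q →
    (λ le → (λ _ → ℓ-cancel-≤ (1≤* (1≤^ q 1≤y) (1≤^ n 1≤b))
               (≤-resp-≈ (sym (ℓ-^ m 1≤b)) (right n q) (*-monoʳ-≤ (0≤ℓ 1≤b) le))) ,
            (λ b≤1 → contradiction b≤1 (<⇒≱ 1<b))) ,
    (λ le → (λ _ → ℓ-cancel-≤ (1≤^ m 1≤b)
               (≤-resp-≈ (right n q) (sym (ℓ-^ m 1≤b)) (*-monoʳ-≤ (0≤ℓ 1≤b) le))) ,
            (λ b≤1 → contradiction b≤1 (<⇒≱ 1<b)))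
    where
    1≤b = <⇒≤ 1<b

    right : ∀ n q → (fromℕ n + fromℕ q * t) * ℓ b ≈ ℓ (y ^ q * b ^ n)
    right n q = trans
      (solve 4 (λ n q t l → (n :+ q :* t) :* l := q :* (t :* l) :+ n :* l) refl (fromℕ n) (fromℕ q) t (ℓ b))
      (trans (+-congʳ (*-congˡ tℓb≈ℓy)) (sym (ℓ-monomial q n 1≤b 1≤y)))

  -- A fraction with denominator Q brackets `t` to within 1 / Q, and `clause` transports the bracket
  -- to `y`. Multiplied by Q, the error is `ℓ b` for every Q.
  IsPow-elim : ∀ {b t y} → 1# < b → 1# ≤ y → IsPow b t y → t * ℓ b ≈ ℓ y
  IsPow-elim {b} {t} {y} 1<b 1≤y (_ , clause) =
    antisym (≤-by-multiples {c = ℓ b} upper) (≤-by-multiples {c = ℓ b} lower)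
    where
    1≤b = <⇒≤ 1<b
    module _ (p : ℕ) where
      Q = fromℕ (suc p)

      -- `t` may be negative a priori, while the exponents in `IsPow` are naturals; adding `n` makes
      -- `floor` applicable.
      shift : ∃[ n ] (0# ≤ fromℕ n + Q * t)
      shift = let (n , -Qt<n) = archimedean (- (Q * t)) in n , ≤-resp-≈ (-‿inverseˡ (Q * t)) refl (+-monoˡ-≤ (Q * t) (<⇒≤ -Qt<n))

      n = proj₁ shift
      split = floor (proj₂ shift)
      a = proj₁ split

      below : fromℕ a * ℓ b ≤ Q * ℓ y + fromℕ n * ℓ b
      below = ≤-resp-≈ (ℓ-^ a 1≤b) (ℓ-monomial (suc p) n 1≤b 1≤y)
        (ℓ-mono (1≤^ a 1≤b) (proj₁ (proj₁ (clause a n (suc p)) (proj₁ (proj₂ split))) 1≤b))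

      above : Q * ℓ y + fromℕ n * ℓ b ≤ fromℕ (suc a) * ℓ b
      above = ≤-resp-≈ (ℓ-monomial (suc p) n 1≤b 1≤y) (ℓ-^ (suc a) 1≤b)
        (ℓ-mono (1≤* (1≤^ (suc p) 1≤y) (1≤^ n 1≤b))
          (proj₁ (proj₂ (clause (suc a) n (suc p)) (<⇒≤ (proj₂ (proj₂ split)))) 1≤b))

      upper : Q * (t * ℓ b) ≤ Q * ℓ y + ℓ b
      upper = +-cancelʳ-≤ (fromℕ n * ℓ b) (begin
        Q * (t * ℓ b) + fromℕ n * ℓ b   ≈⟨ solve 4 (λ Q t l n → Q :* (t :* l) :+ n :* l := (n :+ Q :* t) :* l) refl Q t (ℓ b) (fromℕ n) ⟩
        (fromℕ n + Q * t) * ℓ b         ≤⟨ *-monoʳ-≤ (0≤ℓ 1≤b) (<⇒≤ (proj₂ (proj₂ split))) ⟩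
        (1# + fromℕ a) * ℓ b            ≈⟨ solve 2 (λ a l → (con 1 :+ a) :* l := a :* l :+ l) refl (fromℕ a) (ℓ b) ⟩
        fromℕ a * ℓ b + ℓ b             ≤⟨ +-monoˡ-≤ (ℓ b) below ⟩
        Q * ℓ y + fromℕ n * ℓ b + ℓ b   ≈⟨ solve 3 (λ u v l → u :+ v :+ l := u :+ l :+ v) refl (Q * ℓ y) (fromℕ n * ℓ b) (ℓ b) ⟩
        Q * ℓ y + ℓ b + fromℕ n * ℓ b   ∎)

      lower : Q * ℓ y ≤ Q * (t * ℓ b) + ℓ b
      lower = +-cancelʳ-≤ (fromℕ n * ℓ b) (begin
        Q * ℓ y + fromℕ n * ℓ b         ≤⟨ above ⟩
        (1# + fromℕ a) * ℓ b            ≤⟨ *-monoʳ-≤ (0≤ℓ 1≤b) (+-monoʳ-≤ 1# (proj₁ (proj₂ split))) ⟩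
        (1# + (fromℕ n + Q * t)) * ℓ b  ≈⟨ solve 4 (λ Q t l n → (con 1 :+ (n :+ Q :* t)) :* l := Q :* (t :* l) :+ l :+ n :* l) refl Q t (ℓ b) (fromℕ n) ⟩
        Q * (t * ℓ b) + ℓ b + fromℕ n * ℓ b ∎)

  -- Change of base in product form. `IsPow-intro` shows that a logarithm exists, and `IsPow-elim`
  -- applies to whichever one `the` returns.
  log-ℓ : ∀ {b y} → 1# < b → 1# ≤ y → log b y * ℓ b ≈ ℓ y
  log-ℓ {b} {y} 1<b 1≤y = IsPow-elim 1<b 1≤y (the-spec {λ t → IsPow b t y} (ℓ y ÷ ℓ b , IsPow-intro 1<b 1≤y
    (trans (*-comm _ _) (÷-cancel (ℓ y) (0<ℓ 1<b)))))

  log₃≈ℓ : ∀ {y} → 1# ≤ y → log three y ≈ ℓ y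
  log₃≈ℓ {y} 1≤y = trans (sym (*-identityʳ _)) (trans (*-congˡ (sym ℓ-3)) (log-ℓ 1<3 1≤y))

  -- The inverse of the logarithm to base 3

  bernoulli-upper : ∀ {h} n → 0# ≤ h → fromℕ n * (h + h) ≤ 1# → (1# + h) ^ n ≤ 1# + fromℕ n * (h + h)
  bernoulli-upper {h} zero    0≤h _  = ≤-reflexive (solve 1 (λ h → con 1 := con 1 :+ con 0 :* (h :+ h)) refl h)
  bernoulli-upper {h} (suc n) 0≤h le = begin
    (1# + h) * (1# + h) ^ n                  ≤⟨ *-monoˡ-≤ (0≤+ 0≤1 0≤h) (bernoulli-upper n 0≤h le′) ⟩
    (1# + h) * (1# + fromℕ n * (h + h))      ≈⟨ solve 2 (λ h n → (con 1 :+ h) :* (con 1 :+ n :* (h :+ h))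
                                                  := con 1 :+ n :* (h :+ h) :+ h :+ h :* (n :* (h :+ h))) refl h (fromℕ n) ⟩
    -- By `le′` the cross term is at most h, which is exactly the spare half of the doubled slope h
    -- + h.
    1# + fromℕ n * (h + h) + h + h * (fromℕ n * (h + h)) ≤⟨ +-monoʳ-≤ _ (*-monoˡ-≤ 0≤h le′) ⟩
    1# + fromℕ n * (h + h) + h + h * 1#      ≈⟨ solve 2 (λ h n → con 1 :+ n :* (h :+ h) :+ h :+ h :* con 1
                                                  := con 1 :+ (con 1 :+ n) :* (h :+ h)) refl h (fromℕ n) ⟩
    1# + fromℕ (suc n) * (h + h)             ∎
    where
    le′ : fromℕ n * (h + h) ≤ 1#
    le′ = ≤-trans (*-monoʳ-≤ (0≤+ 0≤h 0≤h) (<⇒≤ (fromℕ<fromℕ-suc n))) le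

  -- Continuity of `ℓ` at 1, needed for `exp₃`: h = 1 / (2 N) gives (1 + h)^N ≤ 2 ≤ 3, hence N ℓ (1
  -- + h) ≤ 1.
  small-ℓ : ∀ {ε} → 0# < ε → ∃[ u ] (1# < u × ℓ u ≤ ε)
  small-ℓ {ε} 0<ε with archimedean (1# ÷ ε)
  ... | n , 1/ε<n = 1# + h , x<x+y 1# 0<h , *-cancelˡ-≤ 0<N (begin
    N * ℓ (1# + h)    ≤⟨ ℓ-upper 1 n (x≤x+y 1# (<⇒≤ 0<h)) 1+h≤ ⟩
    fromℕ 1           ≈⟨ trans fromℕ1≈1 (sym (÷-cancel 1# 0<ε)) ⟩
    ε * (1# ÷ ε)      ≤⟨ *-monoˡ-≤ (<⇒≤ 0<ε) (<⇒≤ (<-≤-trans 1/ε<n (<⇒≤ (fromℕ<fromℕ-suc n)))) ⟩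
    ε * N             ≈⟨ *-comm ε N ⟩
    N * ε             ∎)
    where
    N = fromℕ (suc n)
    0<N = 0<fromℕ-suc n
    0<2N = 0<* (0<fromℕ-suc 1) 0<N
    h = (fromℕ 2 * N) ⁻¹
    0<h = 0<⁻¹ 0<2N

    N[h+h]≈1 : N * (h + h) ≈ 1#
    N[h+h]≈1 = trans (solve 2 (λ N h → N :* (h :+ h) := (numeral 2 :* N) :* h) refl N h) (x*x⁻¹ 0<2N)

    1+h≤ : (1# + h) ^ suc n ≤ three ^ 1
    1+h≤ = begin
      (1# + h) ^ suc n        ≤⟨ bernoulli-upper (suc n) (<⇒≤ 0<h) (≤-reflexive N[h+h]≈1) ⟩
      1# + N * (h + h)        ≈⟨ +-congˡ N[h+h]≈1 ⟩
      1# + 1#                 ≤⟨ x≤x+y _ 0≤1 ⟩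
      1# + 1# + 1#            ≈⟨ solve 0 (con 1 :+ con 1 :+ con 1 := numeral 3 :* con 1) refl ⟩
      three ^ 1               ∎

  -- T is the supremum of the x ≥ 1 with ℓ x ≤ s. If ℓ T missed s, a factor u > 1 with ℓ u within
  -- the gap would contradict that T is an upper bound, or that it is the least one.
  exp₃ : ∀ {s} → 0# ≤ s → ∃[ T ] (1# ≤ T × ℓ T ≈ s)
  exp₃ {s} 0≤s = T , 1≤T , antisym (≮⇒≥ ¬s<ℓT) (≮⇒≥ ¬ℓT<s)
    where
    Below : Pred Carrier 0ℓ
    Below x = 1# ≤ x × ℓ x ≤ s

    bounded : ∃[ u ] (∀ x → Below x → x ≤ u)
    bounded = let (n , s<n) = archimedean s in three ^ n , λ x (1≤x , ℓx≤s) → ℓ-cancel-≤ (1≤^ n (<⇒≤ 1<3))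
      (≤-trans ℓx≤s (≤-trans (<⇒≤ s<n) (≤-reflexive (sym (trans (ℓ-^ n (<⇒≤ 1<3)) (trans (*-congˡ ℓ-3) (*-identityʳ _)))))))

    sup = complete Below (1# , ≤-refl , ≤-trans (≤-reflexive ℓ-1) 0≤s) bounded
    T = proj₁ sup

    1≤T : 1# ≤ T
    1≤T = proj₁ (proj₂ sup) 1# (≤-refl , ≤-trans (≤-reflexive ℓ-1) 0≤s)

    T<Tu : ∀ {u} → 1# < u → T < T * u
    T<Tu 1<u = <-resp-≈ (*-identityʳ T) refl (*-monoˡ-< (1≤⇒0< 1≤T) 1<u)

    ¬ℓT<s : ¬ (ℓ T < s)
    ¬ℓT<s ℓT<s =
      let (d , 0<d , s≈ℓT+d) = difference-< ℓT<s
          (u , 1<u , ℓu≤d)   = small-ℓ 0<d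
      in <⇒≱ (T<Tu 1<u) (proj₁ (proj₂ sup) (T * u) (1≤* 1≤T (<⇒≤ 1<u) , (begin
           ℓ (T * u)   ≈⟨ ℓ-* 1≤T (<⇒≤ 1<u) ⟩
           ℓ T + ℓ u   ≤⟨ +-monoʳ-≤ (ℓ T) ℓu≤d ⟩
           ℓ T + d     ≈⟨ s≈ℓT+d ⟨
           s           ∎)))

    ¬s<ℓT : ¬ (s < ℓ T)
    ¬s<ℓT s<ℓT =
      let (d , 0<d , ℓT≈s+d) = difference-< s<ℓT
          (u , 1<u , ℓu≤d)   = small-ℓ 0<d
          0<u                = 1≤⇒0< (<⇒≤ 1<u)
          T≤T÷u = proj₂ (proj₂ sup) (T ÷ u) λ x (1≤x , ℓx≤s) → *-cancelˡ-≤ 0<u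
            (≤-trans (ℓ-cancel-≤ 1≤T (begin
               ℓ (u * x)   ≈⟨ ℓ-* (<⇒≤ 1<u) 1≤x ⟩
               ℓ u + ℓ x   ≤⟨ +-mono-≤ ℓu≤d ℓx≤s ⟩
               d + s       ≈⟨ trans (+-comm d s) (sym ℓT≈s+d) ⟩
               ℓ T         ∎))
             (≤-reflexive (sym (÷-cancel T 0<u))))
      in <⇒≱ (T<Tu 1<u) (≤-resp-≈ (*-comm u T) (÷-cancel T 0<u) (*-monoˡ-≤ (<⇒≤ 0<u) T≤T÷u))

  -- Powers with base 3^(-n) or 0

  module _ {c s T} (n : ℕ) (c3ⁿ≈1 : c * three ^ n ≈ 1#) (0≤s : 0# ≤ s) (1≤T : 1# ≤ T) (ℓT≈s : ℓ T ≈ s) where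

    private
      X = three ^ n
      Z = T ^ n
      1≤X = 1≤^ n (<⇒≤ 1<3)
      1≤Z = 1≤^ n 1≤T
      0<c : 0# < c
      0<c = [ (λ lt → lt) , (λ c≤0 → contradiction
        (≤-resp-≈ c3ⁿ≈1 (zeroˡ X) (*-monoʳ-≤ (1≤⇒0≤ 1≤X) c≤0)) (<⇒≱ 0<1)) ]′ (<-or-≥ 0# c)
      c≤1 : c ≤ 1#
      c≤1 = ≤-resp-≈ (*-identityʳ c) c3ⁿ≈1 (*-monoˡ-≤ (<⇒≤ 0<c) 1≤X)

      inverse-^ : ∀ {u v} m → u * v ≈ 1# → u ^ m * v ^ m ≈ 1#
      inverse-^ {u} {v} m uv≈1 = trans (sym (^-distrib-* u v m)) (trans (^-congˡ m uv≈1) (1^n≈1 m))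

      ℓ-X : ∀ m → ℓ (X ^ m) ≈ fromℕ n * fromℕ m
      ℓ-X m = trans (ℓ-^ m 1≤X) (trans (*-congˡ (trans (ℓ-^ n (<⇒≤ 1<3)) (trans (*-congˡ ℓ-3) (*-identityʳ _)))) (*-comm _ _))

      ℓ-ZX : ∀ n′ q → ℓ (Z ^ q * X ^ n′) ≈ fromℕ n * (fromℕ n′ + fromℕ q * s)
      ℓ-ZX n′ q = trans (ℓ-* (1≤^ q 1≤Z) (1≤^ n′ 1≤X))
        (trans (+-cong (trans (ℓ-^ q 1≤Z) (*-congˡ (trans (ℓ-^ n 1≤T) (*-congˡ ℓT≈s)))) (ℓ-X n′))
          (solve 4 (λ n n′ q s → q :* (n :* s) :+ n :* n′ := n :* (n′ :+ q :* s)) refl (fromℕ n) (fromℕ n′) (fromℕ q) s))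

      -- Since c ≤ 1, the clauses of `IsPow` for 1 ≤ c concern only c = 1, that is n = 0, where both
      -- sides of the logarithmic inequality vanish.
      1≤c⇒n≈0 : 1# ≤ c → ∀ x y → fromℕ n * x ≤ fromℕ n * y
      1≤c⇒n≈0 1≤c x y = ≤-reflexive (trans (*-congʳ n≈0) (trans (zeroˡ x) (sym (trans (*-congʳ n≈0) (zeroˡ y)))))
        where
        n≈0 : fromℕ n ≈ 0#
        n≈0 = antisym (begin
          fromℕ n             ≈⟨ trans (*-congˡ fromℕ1≈1) (*-identityʳ _) ⟨
          fromℕ n * fromℕ 1   ≈⟨ ℓ-X 1 ⟨
          ℓ (X ^ 1)           ≤⟨ ℓ-mono (1≤^ 1 1≤X) (begin
             X * 1#              ≤⟨ *-monoʳ-≤ 0≤1 (≤-resp-≈ (*-identityˡ X) c3ⁿ≈1 (*-monoʳ-≤ (1≤⇒0≤ 1≤X) 1≤c)) ⟩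
             1# * 1#             ≈⟨ *-identityʳ 1# ⟩
             1#                  ∎) ⟩
          ℓ 1#                ≈⟨ ℓ-1 ⟩
          0#                  ∎) (0≤fromℕ n)

    -- `ℓ` is available only from 1 on, so the inequalities are proved for the reciprocals 3^n and
    -- T^n and then inverted.
    IsPow-base-3⁻ⁿ : ∀ {y} → y * T ^ n ≈ 1# → IsPow c s y
    IsPow-base-3⁻ⁿ {y} yZ≈1 = <⇒≤ 0<y , λ m n′ q →
      (λ le → (λ 1≤c → lower m n′ q (1≤c⇒n≈0 1≤c _ _)) , (λ _ → upper m n′ q (*-monoˡ-≤ (0≤fromℕ n) le))) ,
      (λ le → (λ 1≤c → upper m n′ q (1≤c⇒n≈0 1≤c _ _)) , (λ _ → lower m n′ q (*-monoˡ-≤ (0≤fromℕ n) le)))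
      where
      0<y : 0# < y
      0<y = [ (λ lt → lt) , (λ y≤0 → contradiction
        (≤-resp-≈ yZ≈1 (zeroˡ Z) (*-monoʳ-≤ (1≤⇒0≤ 1≤Z) y≤0)) (<⇒≱ 0<1)) ]′ (<-or-≥ 0# y)

      yc-ZX : ∀ n′ q → (y ^ q * c ^ n′) * (Z ^ q * X ^ n′) ≈ 1#
      yc-ZX n′ q = trans (solve 4 (λ a b u v → (a :* b) :* (u :* v) := (a :* u) :* (b :* v)) refl (y ^ q) (c ^ n′) (Z ^ q) (X ^ n′))
        (trans (*-cong (inverse-^ q yZ≈1) (inverse-^ n′ c3ⁿ≈1)) (*-identityʳ 1#))

      reciprocal-≤ : ∀ {a b u v} → 0# ≤ a → 0# ≤ b → a * u ≈ 1# → b * v ≈ 1# → v ≤ u → a ≤ b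
      reciprocal-≤ {a} {b} {u} {v} 0≤a 0≤b au≈1 bv≈1 v≤u = begin
        a              ≈⟨ trans (*-congˡ bv≈1) (*-identityʳ a) ⟨
        a * (b * v)    ≤⟨ *-monoˡ-≤ 0≤a (*-monoˡ-≤ 0≤b v≤u) ⟩
        a * (b * u)    ≈⟨ solve 3 (λ a b u → a :* (b :* u) := b :* (a :* u)) refl a b u ⟩
        b * (a * u)    ≈⟨ trans (*-congˡ au≈1) (*-identityʳ b) ⟩
        b              ∎

      upper : ∀ m n′ q → fromℕ n * fromℕ m ≤ fromℕ n * (fromℕ n′ + fromℕ q * s) → y ^ q * c ^ n′ ≤ c ^ m
      upper m n′ q le = reciprocal-≤ (*-nonNeg (0≤^ q (<⇒≤ 0<y)) (0≤^ n′ (<⇒≤ 0<c))) (0≤^ m (<⇒≤ 0<c)) (yc-ZX n′ q) (inverse-^ m c3ⁿ≈1)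
        (ℓ-cancel-≤ (1≤* (1≤^ q 1≤Z) (1≤^ n′ 1≤X)) (≤-resp-≈ (sym (ℓ-X m)) (sym (ℓ-ZX n′ q)) le))

      lower : ∀ m n′ q → fromℕ n * (fromℕ n′ + fromℕ q * s) ≤ fromℕ n * fromℕ m → c ^ m ≤ y ^ q * c ^ n′
      lower m n′ q le = reciprocal-≤ (0≤^ m (<⇒≤ 0<c)) (*-nonNeg (0≤^ q (<⇒≤ 0<y)) (0≤^ n′ (<⇒≤ 0<c))) (inverse-^ m c3ⁿ≈1) (yc-ZX n′ q)
        (ℓ-cancel-≤ (1≤^ m 1≤X) (≤-resp-≈ (sym (ℓ-ZX n′ q)) (sym (ℓ-X m)) le))

    -- With a the integer part of q s, y^q ≤ c^a and c^(a+1) ≤ y′^q. The ratio of these two powers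
    -- of c is 3^n for all q, so `≤-by-powers` applies.
    IsPow-unique-≤ : ∀ {y y′} → IsPow c s y → IsPow c s y′ → y ≤ y′
    IsPow-unique-≤ {y} {y′} (0≤y , clause) (0≤y′ , clause′) = ≤-by-powers {c = X} 0<y′ 0≤y λ q →
      let (a , a≤qs , qs<a+1) = floor (*-nonNeg (0≤fromℕ q) 0≤s)
      in begin
        y ^ q                ≈⟨ *-identityʳ (y ^ q) ⟨
        y ^ q * c ^ 0        ≤⟨ proj₂ (proj₁ (clause a 0 q) (≤-trans a≤qs (≤-reflexive (sym (+-identityˡ _))))) c≤1 ⟩
        c ^ a                ≈⟨ trans (*-congʳ c3ⁿ≈1) (*-identityˡ _) ⟨
        c * X * c ^ a        ≈⟨ solve 3 (λ c X p → c :* X :* p := X :* (c :* p)) refl c X (c ^ a) ⟩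
        X * c ^ suc a        ≤⟨ *-monoˡ-≤ (1≤⇒0≤ 1≤X) (proj₂ (proj₂ (clause′ (suc a) 0 q) (≤-trans (≤-reflexive (+-identityˡ _)) (<⇒≤ qs<a+1))) c≤1) ⟩
        X * (y′ ^ q * c ^ 0) ≈⟨ *-congˡ (*-identityʳ (y′ ^ q)) ⟩
        X * y′ ^ q           ∎
      where
      0<y′ : 0# < y′
      0<y′ = let (a , _ , s<a+1) = floor 0≤s in begin-strict
        0#               <⟨ 0<^ (suc a) 0<c ⟩
        c ^ suc a        ≤⟨ proj₂ (proj₂ (clause′ (suc a) 0 1) (≤-trans (≤-reflexive (trans (+-identityˡ _) (trans (*-congʳ fromℕ1≈1) (*-identityˡ s)))) (<⇒≤ s<a+1))) c≤1 ⟩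
        y′ ^ 1 * c ^ 0   ≈⟨ trans (*-identityʳ _) (*-identityʳ y′) ⟩
        y′               ∎

    pow-base-3⁻ⁿ : pow c s * T ^ n ≈ 1#
    pow-base-3⁻ⁿ = trans (*-congʳ (antisym (IsPow-unique-≤ isPow isPow₀) (IsPow-unique-≤ isPow₀ isPow))) y₀Z≈1
      where
      y₀Z≈1 : (T ^ n) ⁻¹ * T ^ n ≈ 1#
      y₀Z≈1 = trans (*-comm _ _) (x*x⁻¹ (1≤⇒0< 1≤Z))

      isPow₀ = IsPow-base-3⁻ⁿ y₀Z≈1
      isPow : IsPow c s (pow c s)
      isPow = the-spec {IsPow c s} (_ , isPow₀)

  -- Zero satisfies all conditions. Conversely, an exponent q with q s ≥ 1 gives y^q ≤ c^1 = 0 for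
  -- every solution y.
  pow-base-0 : ∀ {c s} → c ≈ 0# → 0# < s → pow c s ≈ 0#
  pow-base-0 {c} {s} c≈0 0<s = antisym pow≤0 (proj₁ isPow)
    where
    c≤1 : c ≤ 1#
    c≤1 = ≤-trans (≤-reflexive c≈0) 0≤1

    c^suc≈0 : ∀ m → c ^ suc m ≈ 0#
    c^suc≈0 m = trans (*-congʳ c≈0) (zeroˡ _)

    0≤c^ : ∀ m → 0# ≤ c ^ m
    0≤c^ m = 0≤^ m (≤-reflexive (sym c≈0))

    upper : ∀ m n q → fromℕ m ≤ fromℕ n + fromℕ q * s → 0# ^ q * c ^ n ≤ c ^ m
    upper m       n       (suc q) _  = ≤-trans (≤-reflexive (trans (*-congʳ (zeroˡ _)) (zeroˡ _))) (0≤c^ m)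
    upper m       (suc n) zero    _  = ≤-trans (≤-reflexive (trans (*-identityˡ _) (c^suc≈0 n))) (0≤c^ m)
    upper zero    zero    zero    _  = ≤-reflexive (*-identityˡ _)
    upper (suc m) zero    zero    le = contradiction (≤-trans le (≤-reflexive (trans (+-identityˡ _) (zeroˡ s)))) (<⇒≱ (0<fromℕ-suc m))

    lower : ∀ m n q → fromℕ n + fromℕ q * s ≤ fromℕ m → c ^ m ≤ 0# ^ q * c ^ n
    lower (suc m) n       q       _  = ≤-trans (≤-reflexive (c^suc≈0 m)) (*-nonNeg (0≤^ q ≤-refl) (0≤c^ n))
    lower zero    zero    zero    _  = ≤-reflexive (sym (*-identityˡ _))
    -- The conclusion would be 1 ≤ 0; here s > 0 makes the premise false.
    lower zero    zero    (suc q) le = contradiction (≤-trans (≤-reflexive (sym (+-identityˡ _))) le) (<⇒≱ (0<* (0<fromℕ-suc q) 0<s))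
    lower zero    (suc n) q       le = contradiction (≤-trans (x≤x+y _ (*-nonNeg (0≤fromℕ q) (<⇒≤ 0<s))) le) (<⇒≱ (0<fromℕ-suc n))

    ¬1≤c : ¬ (1# ≤ c)
    ¬1≤c 1≤c = <⇒≱ 0<1 (≤-trans 1≤c (≤-reflexive c≈0))

    isPow₀ : IsPow c s 0#
    isPow₀ = ≤-refl , λ m n q →
      (λ le → (λ 1≤c → contradiction 1≤c ¬1≤c) , (λ _ → upper m n q le)) ,
      (λ le → (λ 1≤c → contradiction 1≤c ¬1≤c) , (λ _ → lower m n q le))

    isPow : IsPow c s (pow c s)
    isPow = the-spec {IsPow c s} (_ , isPow₀)

    pow≤0 : pow c s ≤ 0#
    pow≤0 = let (q , 1/s<q) = archimedean (1# ÷ s) in ≮⇒≥ λ 0<p → <⇒≱ (0<^ q 0<p) (begin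
      pow c s ^ q           ≈⟨ *-identityʳ _ ⟨
      pow c s ^ q * c ^ 0   ≤⟨ proj₂ (proj₁ (proj₂ isPow 1 0 q) (begin
         fromℕ 1               ≈⟨ trans fromℕ1≈1 (sym (÷-cancel 1# 0<s)) ⟩
         s * (1# ÷ s)          ≤⟨ *-monoˡ-≤ (<⇒≤ 0<s) (<⇒≤ 1/s<q) ⟩
         s * fromℕ q           ≈⟨ trans (*-comm s _) (sym (+-identityˡ _)) ⟩
         0# + fromℕ q * s      ∎)) c≤1 ⟩
      c ^ 1                 ≈⟨ c^suc≈0 0 ⟩
      0#                    ∎)

-- Finite sums, 3-adic distances and diameters

module Hausdorff (em : ExcludedMiddle (lsuc 0ℓ)) (R : CompleteOrderedField) where

  open OrderedField em R
  open Logarithm em R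

  -- Finite sums

  Σ-mono : ∀ {f g : ℕ → Carrier} N → (∀ i → f i ≤ g i) → Σ< N f ≤ Σ< N g
  Σ-mono zero    f≤g = ≤-refl
  Σ-mono (suc N) f≤g = +-mono-≤ (f≤g 0) (Σ-mono N (λ i → f≤g (suc i)))

  0≤Σ : ∀ {f : ℕ → Carrier} N → (∀ i → 0# ≤ f i) → 0# ≤ Σ< N f
  0≤Σ zero    0≤f = ≤-refl
  0≤Σ (suc N) 0≤f = 0≤+ (0≤f 0) (0≤Σ N (λ i → 0≤f (suc i)))

  Σ-monoˡ : ∀ {f : ℕ → Carrier} {M N} → (∀ i → 0# ≤ f i) → M ℕ.≤ N → Σ< M f ≤ Σ< N f
  Σ-monoˡ {N = N} 0≤f z≤n       = 0≤Σ N 0≤f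
  Σ-monoˡ         0≤f (s≤s M≤N) = +-monoʳ-≤ _ (Σ-monoˡ (λ i → 0≤f (suc i)) M≤N)

  term≤Σ : ∀ {f : ℕ → Carrier} i → (∀ i → 0# ≤ f i) → f i ≤ Σ< (suc i) f
  term≤Σ zero    0≤f = x≤x+y _ ≤-refl
  term≤Σ (suc i) 0≤f = ≤-trans (term≤Σ i (λ i → 0≤f (suc i))) (≤-trans (x≤x+y _ (0≤f 0)) (≤-reflexive (+-comm _ _)))

  Σ-+ : ∀ {f g : ℕ → Carrier} N → Σ< N (λ i → f i + g i) ≈ Σ< N f + Σ< N g
  Σ-+ zero = sym (+-identityˡ 0#)
  Σ-+ {f} {g} (suc N) = trans (+-congˡ (Σ-+ {f ∘ suc} {g ∘ suc} N))
    (solve 4 (λ a b u v → (a :+ b) :+ (u :+ v) := (a :+ u) :+ (b :+ v)) refl (f 0) (g 0)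
       (Σ< N (λ i → f (suc i))) (Σ< N (λ i → g (suc i))))

  Σ-scale : ∀ {f g : ℕ → Carrier} c N → (∀ i → f i ≈ c * g i) → Σ< N f ≈ c * Σ< N g
  Σ-scale c zero    f≈cg = sym (zeroʳ c)
  Σ-scale {f} {g} c (suc N) f≈cg = trans (+-cong (f≈cg 0) (Σ-scale c N (λ i → f≈cg (suc i))))
    (solve 3 (λ c a b → c :* a :+ c :* b := c :* (a :+ b)) refl c (g 0) (Σ< N (λ i → g (suc i))))

  -- Distances and diameters

  least : ∀ (P : ℕ → Set) n → P n → ∃[ m ] (P m × (∀ j → j ℕ.< m → ¬ P j))
  least P n pn = below (suc n) (n , ℕ.≤-refl , pn)
    where
    below : ∀ n → ∃[ m ] (m ℕ.< n × P m) → ∃[ m ] (P m × (∀ j → j ℕ.< m → ¬ P j))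
    below (suc n) (m , s≤s m≤n , pm) with decide (∃[ j ] (j ℕ.< n × P j))
    ... | yes smaller = below n smaller
    ... | no ¬smaller = m , pm , λ j j<m pj → ¬smaller (j , ℕ.<-≤-trans j<m m≤n , pj)

  AgreeBelow : ℕ → ℤ₃ → ℤ₃ → Set
  AgreeBelow n x y = ∀ j → j ℕ.< n → x j ≡ y j

  compare : ∀ (x y : ℤ₃) → (∀ j → x j ≡ y j) ⊎ ∃[ n ] (AgreeBelow n x y × x n ≢ y n)
  compare x y with decide (∃[ n ] x n ≢ y n)
  ... | no ¬differ = inj₁ λ j → [ (λ eq → eq) , (λ neq → contradiction (j , neq) ¬differ) ]′ (equal? j)
    where
    equal? : ∀ j → x j ≡ y j ⊎ x j ≢ y j
    equal? j with x j Fin.≟ y j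
    ... | yes eq = inj₁ eq
    ... | no neq = inj₂ neq
  ... | yes (n , neq) with least (λ n → x n ≢ y n) n neq
  ...   | m , neq′ , minimal = inj₂ (m , agree , neq′)
    where
    agree : AgreeBelow m x y
    agree j j<m with x j Fin.≟ y j
    ... | yes eq = eq
    ... | no neq = contradiction neq (minimal j j<m)

  3⁻_ : ℕ → Carrier
  3⁻ n = (three ^ n) ⁻¹

  1≤3^ : ∀ n → 1# ≤ three ^ n
  1≤3^ n = 1≤^ n (<⇒≤ 1<3)

  3⁻ⁿ*3ⁿ≈1 : ∀ n → 3⁻ n * three ^ n ≈ 1#
  3⁻ⁿ*3ⁿ≈1 n = trans (*-comm _ _) (x*x⁻¹ (1≤⇒0< (1≤3^ n)))

  0<3⁻ : ∀ n → 0# < 3⁻ n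
  0<3⁻ n = 0<⁻¹ (1≤⇒0< (1≤3^ n))

  3⁻-anti : ∀ {m n} → n ℕ.≤ m → 3⁻ m ≤ 3⁻ n
  3⁻-anti {m} {n} n≤m = *-cancelˡ-≤ (1≤⇒0< (1≤3^ n)) (begin
    three ^ n * 3⁻ m    ≤⟨ *-monoʳ-≤ (<⇒≤ (0<3⁻ m)) (^-monoʳ-≤ (<⇒≤ 1<3) n≤m) ⟩
    three ^ m * 3⁻ m    ≈⟨ x*x⁻¹ (1≤⇒0< (1≤3^ m)) ⟩
    1#                  ≈⟨ x*x⁻¹ (1≤⇒0< (1≤3^ n)) ⟨
    three ^ n * 3⁻ n    ∎)

  IsDist : ℤ₃ → ℤ₃ → Pred Carrier 0ℓ
  IsDist x y r = ((∀ j → x j ≡ y j) → r ≈ 0#) ×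
                 (∀ n → AgreeBelow n x y → x n ≢ y n → r ≈ 3⁻ n)

  first-difference-unique : ∀ {x y m n} → AgreeBelow m x y → x m ≢ y m → AgreeBelow n x y → x n ≢ y n → m ≡ n
  first-difference-unique {m = m} {n} agree-m differ-m agree-n differ-n = ℕ.≤-antisym
    (ℕ.≮⇒≥ λ n<m → differ-n (agree-m n n<m)) (ℕ.≮⇒≥ λ m<n → differ-m (agree-n m m<n))

  isDist : ∀ x y → IsDist x y (dist x y)
  isDist x y = the-spec {IsDist x y} ([ equal , different ]′ (compare x y))
    where
    equal : (∀ j → x j ≡ y j) → ∃ (IsDist x y)
    equal eq = 0# , (λ _ → refl) , λ n _ neq → contradiction (eq n) neq

    different : ∃[ n ] (AgreeBelow n x y × x n ≢ y n) → ∃ (IsDist x y)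
    different (n , agree , neq) = 3⁻ n , (λ eq → contradiction (eq n) neq) ,
      λ n′ agree′ neq′ → reflexive (≡.cong 3⁻_ (first-difference-unique agree neq agree′ neq′))

  dist-≤ : ∀ {x y} n → AgreeBelow n x y → dist x y ≤ 3⁻ n
  dist-≤ {x} {y} n agree = [ equal , different ]′ (compare x y)
    where
    equal : (∀ j → x j ≡ y j) → dist x y ≤ 3⁻ n
    equal eq = ≤-trans (≤-reflexive (proj₁ (isDist x y) eq)) (<⇒≤ (0<3⁻ n))

    different : ∃[ m ] (AgreeBelow m x y × x m ≢ y m) → dist x y ≤ 3⁻ n
    different (m , agree′ , neq) = ≤-trans (≤-reflexive (proj₂ (isDist x y) m agree′ neq))
      (3⁻-anti (ℕ.≮⇒≥ λ m<n → neq (agree m m<n)))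

  Distances : Pred ℤ₃ 0ℓ → Pred Carrier 0ℓ
  Distances U r = r ≈ 0# ⊎ (∃[ x ] ∃[ y ] (x ∈ U × y ∈ U × r ≈ dist x y))

  diam-unique : ∀ {U r} → IsLub (Distances U) r → diam U ≈ r
  diam-unique {U} {r} lub = lub-unique (the-spec {IsLub (Distances U)} (r , lub)) lub

  diam≈0 : ∀ {U} → (∀ {x y} → x ∈ U → y ∈ U → ∀ j → x j ≡ y j) → diam U ≈ 0#
  diam≈0 {U} equal = diam-unique (upper , λ u ub → ub 0# (inj₁ refl))
    where
    upper : ∀ r → Distances U r → r ≤ 0#
    upper r (inj₁ r≈0) = ≤-reflexive r≈0
    upper r (inj₂ (x , y , x∈U , y∈U , r≈d)) = ≤-reflexive (trans r≈d (proj₁ (isDist x y) (equal x∈U y∈U)))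

  diam≈3⁻ⁿ : ∀ {U} n {x y} → (∀ {x y} → x ∈ U → y ∈ U → AgreeBelow n x y) →
             x ∈ U → y ∈ U → x n ≢ y n → diam U ≈ 3⁻ n
  diam≈3⁻ⁿ {U} n {x} {y} agree x∈U y∈U neq = diam-unique
    (upper , λ u ub → ub (3⁻ n) (inj₂ (x , y , x∈U , y∈U , sym (proj₂ (isDist x y) n (agree x∈U y∈U) neq))))
    where
    upper : ∀ r → Distances U r → r ≤ 3⁻ n
    upper r (inj₁ r≈0) = ≤-trans (≤-reflexive r≈0) (<⇒≤ (0<3⁻ n))
    upper r (inj₂ (x , y , x∈U , y∈U , r≈d)) = ≤-trans (≤-reflexive r≈d) (dist-≤ n (agree x∈U y∈U))

  Cylinder : ℤ₃ → ℕ → Pred ℤ₃ 0ℓ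
  Cylinder c n x = AgreeBelow n x c

  -- The value is attained by two continuations of the centre whose digits first differ at index
  -- `n`.
  diam-cylinder : ∀ c n → diam (Cylinder c n) ≈ 3⁻ n
  diam-cylinder c n = diam≈3⁻ⁿ n (λ x∈ y∈ j j<n → ≡.trans (x∈ j j<n) (≡.sym (y∈ j j<n)))
    (extend-∈ Fin.zero) (extend-∈ (Fin.suc Fin.zero)) different
    where
    extend : Fin 3 → ℤ₃
    extend a j with j ℕ.<? n
    ... | yes _ = c j
    ... | no  _ = a

    extend-∈ : ∀ a → extend a ∈ Cylinder c n
    extend-∈ a j j<n with j ℕ.<? n
    ... | yes _  = ≡.refl
    ... | no j≮n = contradiction j<n j≮n

    different : extend Fin.zero n ≢ extend (Fin.suc Fin.zero) n
    different with n ℕ.<? n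
    ... | yes n<n = contradiction n<n (ℕ.<-irrefl ≡.refl)
    ... | no _    = λ ()

  -- The least index at which two members differ determines the diameter, so a set with two distinct
  -- points lies in a cylinder of its own diameter.
  diam-cases : ∀ U → (∀ {x y} → x ∈ U → y ∈ U → ∀ j → x j ≡ y j) ⊎
    ∃[ n ] ((∀ {x y} → x ∈ U → y ∈ U → AgreeBelow n x y) × diam U ≈ 3⁻ n)
  diam-cases U = [ different , equal ]′ (decide-differ (decide (∃ Differ)))
    where
    Differ : ℕ → Set
    Differ n = ∃[ x ] ∃[ y ] (x ∈ U × y ∈ U × x n ≢ y n)

    Result = (∀ {x y} → x ∈ U → y ∈ U → ∀ j → x j ≡ y j) ⊎
      ∃[ n ] ((∀ {x y} → x ∈ U → y ∈ U → AgreeBelow n x y) × diam U ≈ 3⁻ n)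

    decide-differ : Dec (∃ Differ) → ∃ Differ ⊎ ¬ ∃ Differ
    decide-differ (yes p) = inj₁ p
    decide-differ (no ¬p) = inj₂ ¬p

    agree-at : ∀ {x y} → x ∈ U → y ∈ U → ∀ j → ¬ Differ j → x j ≡ y j
    agree-at {x} {y} x∈U y∈U j ¬differ with x j Fin.≟ y j
    ... | yes eq = eq
    ... | no neq = contradiction (x , y , x∈U , y∈U , neq) ¬differ

    equal : ¬ ∃ Differ → Result
    equal ¬differ = inj₁ λ x∈U y∈U j → agree-at x∈U y∈U j (λ d → ¬differ (j , d))

    different : ∃ Differ → Result
    different (n , d) =
      let (m , (x , y , x∈U , y∈U , neq) , minimal) = least Differ n d
          agree : ∀ {x y} → x ∈ U → y ∈ U → AgreeBelow m x y
          agree x∈U y∈U j j<m = agree-at x∈U y∈U j (minimal j j<m)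
      in inj₂ (m , agree , diam≈3⁻ⁿ m agree x∈U y∈U neq)

  -- The dimension of the path set, for k = m + 1

  module PathSet (m : ℕ) (β : Carrier) (1<β : 1# < β) (β-root : β ^ suc m ≈ β ^ m + 1#) where

    open Automaton using (Step; stay; jump; drop; IsPath; path⇒𝒞; 𝒞⇒path)

    1≤β = <⇒≤ 1<β
    0<β = 1≤⇒0< 1≤β

    -- The upper bound

    cons : Fin 3 → ℤ₃ → ℤ₃
    cons a c zero    = a
    cons a c (suc i) = c i

    0₃ 1₃ : Fin 3
    0₃ = Fin.zero
    1₃ = Fin.suc Fin.zero

    -- One centre, continued by zeros, for each word of length `n` that can be read from state `j`.
    centres : ℕ → ℕ → List ℤ₃
    centres zero    j       = (λ _ → 0₃) ∷ []
    centres (suc n) zero    = map (cons 0₃) (centres n 0) ++ map (cons 1₃) (centres n m)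
    centres (suc n) (suc j) = map (cons 0₃) (centres n j)

    cons-cylinder : ∀ {x a c n} → toℕ (x 0) ≡ toℕ a → x ∘ suc ∈ Cylinder c n → x ∈ Cylinder (cons a c) (suc n)
    cons-cylinder eq tail∈ zero    _         = Fin.toℕ-injective eq
    cons-cylinder eq tail∈ (suc i) (s≤s i<n) = tail∈ i i<n

    centres-cover : ∀ n {j} x (σ : ℕ → ℕ) → σ 0 ≡ j → (∀ i → Step m (σ i) (toℕ (x i)) (σ (suc i))) →
                    Any (λ c → x ∈ Cylinder c n) (centres n j)
    centres-cover zero x σ σ0≡j steps = here λ _ ()
    centres-cover (suc n) {j} x σ σ0≡j steps = first σ0≡j ≡.refl ≡.refl (steps 0)
      where
      rest : ∀ {i} → σ 1 ≡ i → Any (λ c → x ∘ suc ∈ Cylinder c n) (centres n i)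
      rest eq = centres-cover n (x ∘ suc) (σ ∘ suc) eq (steps ∘ suc)

      lift-cons : ∀ {a cs} → toℕ (x 0) ≡ toℕ a → Any (λ c → x ∘ suc ∈ Cylinder c n) cs →
                  Any (λ c → x ∈ Cylinder c (suc n)) (map (cons a) cs)
      lift-cons eq any = Any.map⁺ (Any.map (cons-cylinder eq) any)

      first : ∀ {i d i′} → i ≡ j → d ≡ toℕ (x 0) → i′ ≡ σ 1 → Step m i d i′ →
              Any (λ c → x ∈ Cylinder c (suc n)) (centres (suc n) j)
      first ≡.refl deq eq stay = Any.++⁺ˡ (lift-cons (≡.sym deq) (rest (≡.sym eq)))
      first ≡.refl deq eq jump = Any.++⁺ʳ (map (cons 0₃) (centres n 0)) (lift-cons (≡.sym deq) (rest (≡.sym eq)))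
      first ≡.refl deq eq drop = lift-cons (≡.sym deq) (rest (≡.sym eq))

    -- Multiplying by β^j, the inverse of h(j), keeps the claim free of negative powers. The surplus
    -- β^m pays for the empty word, where β^j can be as large as β^m.
    centres-count : ∀ n {j} → j ℕ.≤ m → β ^ j * fromℕ (length (centres n j)) ≤ β ^ (n ℕ.+ m)
    centres-count zero {j} j≤m = begin
      β ^ j * fromℕ 1   ≈⟨ trans (*-congˡ fromℕ1≈1) (*-identityʳ _) ⟩
      β ^ j             ≤⟨ ^-monoʳ-≤ 1≤β j≤m ⟩
      β ^ m             ∎
    -- The factor β^m makes the bound for state m applicable; the two branches then add up to (β^m +
    -- 1) P, which the equation of β turns into β^m (β P).
    centres-count (suc n) {zero} _ = *-cancelˡ-≤ (0<^ m 0<β) (begin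
      β ^ m * (1# * fromℕ (length (centres (suc n) 0)))
        ≡⟨ ≡.cong (λ l → β ^ m * (1# * fromℕ l)) (≡.trans (List.length-++ (map (cons 0₃) (centres n 0)))
             (≡.cong₂ ℕ._+_ (List.length-map (cons 0₃) (centres n 0)) (List.length-map (cons 1₃) (centres n m)))) ⟩
      β ^ m * (1# * fromℕ (length (centres n 0) ℕ.+ length (centres n m)))
        ≈⟨ *-congˡ (*-congˡ (fromℕ-+ (length (centres n 0)) (length (centres n m)))) ⟩
      β ^ m * (1# * (a + b))
        ≈⟨ solve 3 (λ p a b → p :* (con 1 :* (a :+ b)) := p :* (con 1 :* a) :+ p :* b) refl (β ^ m) a b ⟩
      β ^ m * (1# * a) + β ^ m * b
        ≤⟨ +-mono-≤ (*-monoˡ-≤ (0≤^ m (<⇒≤ 0<β)) (centres-count n z≤n)) (centres-count n ℕ.≤-refl) ⟩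
      β ^ m * P + P
        ≈⟨ solve 2 (λ p P → p :* P :+ P := (p :+ con 1) :* P) refl (β ^ m) P ⟩
      (β ^ m + 1#) * P
        ≈⟨ *-congʳ β-root ⟨
      (β * β ^ m) * P
        ≈⟨ solve 3 (λ b p P → (b :* p) :* P := p :* (b :* P)) refl β (β ^ m) P ⟩
      β ^ m * (β * P)   ∎)
      where
      a = fromℕ (length (centres n 0))
      b = fromℕ (length (centres n m))
      P = β ^ (n ℕ.+ m)
    centres-count (suc n) {suc j} j<m = begin
      β ^ suc j * fromℕ (length (map (cons 0₃) (centres n j)))
        ≡⟨ ≡.cong (λ l → β ^ suc j * fromℕ l) (List.length-map (cons 0₃) (centres n j)) ⟩
      (β * β ^ j) * fromℕ (length (centres n j))  ≈⟨ *-assoc _ _ _ ⟩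
      β * (β ^ j * fromℕ (length (centres n j)))  ≤⟨ *-monoˡ-≤ (<⇒≤ 0<β) (centres-count n (ℕ.<⇒≤ j<m)) ⟩
      β * β ^ (n ℕ.+ m)                           ∎

    -- The finite cover as a sequence, padded with empty sets, which have diameter 0.
    family : List ℤ₃ → ℕ → ℕ → Pred ℤ₃ 0ℓ
    family []       n i       = ∅
    family (c ∷ cs) n zero    = Cylinder c n
    family (c ∷ cs) n (suc i) = family cs n i

    family-∋ : ∀ {cs n x} → Any (λ c → x ∈ Cylinder c n) cs → ∃[ i ] (x ∈ family cs n i)
    family-∋ (here x∈)   = 0 , x∈
    family-∋ (there any) = let (i , x∈) = family-∋ any in suc i , x∈

    family-≤ : ∀ (f : Pred ℤ₃ 0ℓ → Carrier) {n v} → f ∅ ≤ v → (∀ c → f (Cylinder c n) ≤ v) →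
               ∀ cs i → f (family cs n i) ≤ v
    family-≤ f f∅≤ fC≤ []       i       = f∅≤
    family-≤ f f∅≤ fC≤ (c ∷ cs) zero    = fC≤ c
    family-≤ f f∅≤ fC≤ (c ∷ cs) (suc i) = family-≤ f f∅≤ fC≤ cs i

    family-Σ : ∀ (f : Pred ℤ₃ 0ℓ → Carrier) {n v} → 0# ≤ v → f ∅ ≤ 0# → (∀ c → f (Cylinder c n) ≤ v) →
               ∀ N cs → Σ< N (λ i → f (family cs n i)) ≤ fromℕ (length cs) * v
    family-Σ f 0≤v f∅≤0 fC≤ zero    cs = *-nonNeg (0≤fromℕ (length cs)) 0≤v
    family-Σ f {v = v} 0≤v f∅≤0 fC≤ (suc N) [] = ≤-resp-≈ refl (+-identityˡ _)
      (+-mono-≤ f∅≤0 (family-Σ f 0≤v f∅≤0 fC≤ N []))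
    family-Σ f {v = v} 0≤v f∅≤0 fC≤ (suc N) (c ∷ cs) = ≤-trans
      (+-mono-≤ (fC≤ c) (family-Σ f 0≤v f∅≤0 fC≤ N cs))
      (≤-reflexive (solve 2 (λ v l → v :+ l :* v := (con 1 :+ l) :* v) refl v (fromℕ (length cs))))

    -- With T = 3^s the cylinders of length n contribute at most β^(n+m) / T^n = β^m / u^n, where u
    -- = T / β exceeds 1 because s > ℓ β.
    null-above : ∀ {s} → ℓ β < s → HausdorffNull (𝒞 (L (suc m))) s
    null-above {s} ℓβ<s δ ε 0<δ 0<ε =
      family cs n ,
      (λ x∈𝒞 → let (σ , σ0≡0 , steps) = 𝒞⇒path x∈𝒞 in family-∋ (centres-cover n _ σ σ0≡0 steps)) ,
      family-≤ diam (≤-trans (≤-reflexive (diam≈0 {∅} λ ())) (<⇒≤ 0<δ))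
        (λ c → ≤-trans (≤-reflexive (diam-cylinder c n)) 3⁻ⁿ≤δ) cs ,
      λ N → ≤-trans
        (family-Σ (λ U → pow (diam U) s) (<⇒≤ 0<v) (≤-reflexive (pow-base-0 (diam≈0 {∅} λ ()) 0<s))
          (λ c → ≤-reflexive (pow-cylinder c)) N cs)
        total≤ε
      where
      0<s : 0# < s
      0<s = ≤-<-trans (0≤ℓ 1≤β) ℓβ<s

      T-data = exp₃ (<⇒≤ 0<s)
      T = proj₁ T-data
      1≤T = proj₁ (proj₂ T-data)
      ℓT≈s = proj₂ (proj₂ T-data)

      β<T : β < T
      β<T = [ (λ lt → lt) , (λ T≤β → contradiction (≤-resp-≈ ℓT≈s refl (ℓ-mono 1≤T T≤β)) (<⇒≱ ℓβ<s)) ]′ (<-or-≥ β T)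

      u-data = quotient 1≤β β<T
      u = proj₁ u-data
      1<u = proj₁ (proj₂ u-data)
      βu≈T = proj₂ (proj₂ u-data)

      δ-large = ^-unbounded 1<3 (1# ÷ δ)
      ε-large = ^-unbounded 1<u (β ^ m ÷ ε)
      -- The sum is at least each threshold: one for the diameters, one for the total.
      n = proj₁ δ-large ℕ.+ proj₁ ε-large
      cs = centres n 0

      3⁻ⁿ≤δ : 3⁻ n ≤ δ
      3⁻ⁿ≤δ = *-cancelˡ-≤ (1≤⇒0< (1≤3^ n)) (begin
        three ^ n * 3⁻ n  ≈⟨ x*x⁻¹ (1≤⇒0< (1≤3^ n)) ⟩
        1#                ≈⟨ ÷-cancel 1# 0<δ ⟨
        δ * (1# ÷ δ)      ≤⟨ *-monoˡ-≤ (<⇒≤ 0<δ) (<⇒≤ (proj₂ δ-large n (ℕ.m≤m+n _ _))) ⟩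
        δ * three ^ n     ≈⟨ *-comm _ _ ⟩
        three ^ n * δ     ∎)

      0<Tⁿ = 1≤⇒0< (1≤^ n 1≤T)
      v = (T ^ n) ⁻¹
      0<v = 0<⁻¹ 0<Tⁿ

      pow-cylinder : ∀ c → pow (diam (Cylinder c n)) s ≈ v
      pow-cylinder c = *-cancelˡ 0<Tⁿ (trans (*-comm _ _) (trans
        (pow-base-3⁻ⁿ n (trans (*-congʳ (diam-cylinder c n)) (3⁻ⁿ*3ⁿ≈1 n)) (<⇒≤ 0<s) 1≤T ℓT≈s)
        (sym (x*x⁻¹ 0<Tⁿ))))

      total≤ε : fromℕ (length cs) * v ≤ ε
      total≤ε = *-cancelˡ-≤ 0<Tⁿ (begin
        T ^ n * (fromℕ (length cs) * v)  ≈⟨ solve 3 (λ t l v → t :* (l :* v) := (t :* v) :* (con 1 :* l)) refl (T ^ n) (fromℕ (length cs)) v ⟩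
        (T ^ n * v) * (1# * fromℕ (length cs)) ≈⟨ trans (*-congʳ (x*x⁻¹ 0<Tⁿ)) (*-identityˡ _) ⟩
        1# * fromℕ (length cs)           ≤⟨ centres-count n z≤n ⟩
        β ^ (n ℕ.+ m)                    ≈⟨ ^-homo-* β n m ⟩
        β ^ n * β ^ m                    ≈⟨ *-congˡ (÷-cancel (β ^ m) 0<ε) ⟨
        β ^ n * (ε * (β ^ m ÷ ε))        ≤⟨ *-monoˡ-≤ (0≤^ n (<⇒≤ 0<β)) (*-monoˡ-≤ (<⇒≤ 0<ε) (<⇒≤ (proj₂ ε-large n (ℕ.m≤n+m _ _)))) ⟩
        β ^ n * (ε * u ^ n)              ≈⟨ solve 3 (λ b e u → b :* (e :* u) := (b :* u) :* e) refl (β ^ n) ε (u ^ n) ⟩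
        (β ^ n * u ^ n) * ε              ≈⟨ *-congʳ (trans (sym (^-distrib-* β u n)) (^-congˡ n βu≈T)) ⟩
        T ^ n * ε                        ∎)

    -- The lower bound

    γ : Carrier
    γ = β ⁻¹

    0<γ : 0# < γ
    0<γ = 0<⁻¹ 0<β

    β*γ≈1 : β * γ ≈ 1#
    β*γ≈1 = x*x⁻¹ 0<β

    βⁿ*γⁿ≈1 : ∀ n → β ^ n * γ ^ n ≈ 1#
    βⁿ*γⁿ≈1 n = trans (sym (^-distrib-* β γ n)) (trans (^-congˡ n β*γ≈1) (1^n≈1 n))

    0≤γ : 0# ≤ γ
    0≤γ = <⇒≤ 0<γ

    γ≤1 : γ ≤ 1#
    γ≤1 = ≤-resp-≈ (*-identityˡ γ) β*γ≈1 (*-monoʳ-≤ 0≤γ 1≤β)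

    -- The equation of β divided by β^(m+1): mass 1 at state 0 splits into γ for digit 0 and γ^(m+1)
    -- for digit 1.
    γ-root : γ * (1# + γ ^ m) ≈ 1#
    γ-root = trans (*-congˡ (+-congʳ (sym (βⁿ*γⁿ≈1 m))))
      (trans (solve 3 (λ b g p → g :* (b :* p :+ p) := (b :+ con 1) :* (g :* p)) refl (β ^ m) γ (γ ^ m))
        (trans (*-congʳ (sym β-root)) (βⁿ*γⁿ≈1 (suc m))))

    Word : Set
    Word = List (Fin 3)

    -- The mass of the cylinder of w among the paths from state j, for the
    -- Markov measure of total mass γ ^ j; the subdivision of mass at state 0
    -- is the equation of β.
    wordMass : ℕ → Word → Carrier
    wordMass j       []                          = γ ^ j
    wordMass zero    (Fin.zero ∷ w)              = γ * wordMass 0 w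
    wordMass zero    (Fin.suc Fin.zero ∷ w)      = γ * wordMass m w
    wordMass zero    (Fin.suc (Fin.suc _) ∷ w)   = 0#
    wordMass (suc j) (Fin.zero ∷ w)              = γ * wordMass j w
    wordMass (suc j) (Fin.suc _ ∷ w)             = 0#

    -- `nothing` is a piece that misses the cylinder of the digits chosen so far, `just []` a piece
    -- that contains it.
    mass : ℕ → Maybe Word → Carrier
    mass j nothing  = 0#
    mass j (just w) = wordMass j w

    0≤wordMass : ∀ j w → 0# ≤ wordMass j w
    0≤wordMass j       []                        = 0≤^ j 0≤γ
    0≤wordMass zero    (Fin.zero ∷ w)            = *-nonNeg 0≤γ (0≤wordMass 0 w)
    0≤wordMass zero    (Fin.suc Fin.zero ∷ w)    = *-nonNeg 0≤γ (0≤wordMass m w)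
    0≤wordMass zero    (Fin.suc (Fin.suc _) ∷ w) = ≤-refl
    0≤wordMass (suc j) (Fin.zero ∷ w)            = *-nonNeg 0≤γ (0≤wordMass j w)
    0≤wordMass (suc j) (Fin.suc _ ∷ w)           = ≤-refl

    0≤mass : ∀ j p → 0# ≤ mass j p
    0≤mass j nothing  = ≤-refl
    0≤mass j (just w) = 0≤wordMass j w

    -- Each digit costs a factor γ or annihilates the mass, and the final γ^j is at most 1.
    wordMass-≤ : ∀ j w → wordMass j w ≤ γ ^ length w
    wordMass-≤ j       []                        = ^-≤1 j 0≤γ γ≤1
    wordMass-≤ zero    (Fin.zero ∷ w)            = *-monoˡ-≤ 0≤γ (wordMass-≤ 0 w)
    wordMass-≤ zero    (Fin.suc Fin.zero ∷ w)    = *-monoˡ-≤ 0≤γ (wordMass-≤ m w)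
    wordMass-≤ zero    (Fin.suc (Fin.suc _) ∷ w) = 0≤^ (suc (length w)) 0≤γ
    wordMass-≤ (suc j) (Fin.zero ∷ w)            = *-monoˡ-≤ 0≤γ (wordMass-≤ j w)
    wordMass-≤ (suc j) (Fin.suc _ ∷ w)           = 0≤^ (suc (length w)) 0≤γ

    match : ∀ {a b : Fin 3} → Dec (a ≡ b) → Word → Maybe Word
    match (yes _) w = just w
    match (no _)  w = nothing

    -- The part of a cylinder that starts with the digit a, with that digit
    -- removed.
    restrict : Fin 3 → Maybe Word → Maybe Word
    restrict a nothing        = nothing
    restrict a (just [])      = just []
    restrict a (just (b ∷ w)) = match (a Fin.≟ b) w

    restrict-∷ : ∀ {a b} w → a ≡ b → restrict a (just (b ∷ w)) ≡ just w
    restrict-∷ {a} {b} w a≡b with a Fin.≟ b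
    ... | yes _  = ≡.refl
    ... | no a≢b = contradiction a≡b a≢b

    -- Additivity of the measure over the two digits; for the full cylinder this is `γ-root`.
    mass-zero : ∀ p → mass 0 p ≈ γ * (mass 0 (restrict 0₃ p) + mass m (restrict 1₃ p))
    mass-zero nothing   = sym (trans (*-congˡ (+-identityˡ 0#)) (zeroʳ γ))
    mass-zero (just []) = sym γ-root
    mass-zero (just (Fin.zero ∷ w))                      = *-congˡ (sym (+-identityʳ _))
    mass-zero (just (Fin.suc Fin.zero ∷ w))              = *-congˡ (sym (+-identityˡ _))
    mass-zero (just (Fin.suc (Fin.suc Fin.zero) ∷ w))    = sym (trans (*-congˡ (+-identityˡ 0#)) (zeroʳ γ))

    mass-suc : ∀ j p → mass (suc j) p ≈ γ * mass j (restrict 0₃ p)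
    mass-suc j nothing                 = sym (zeroʳ γ)
    mass-suc j (just [])               = refl
    mass-suc j (just (Fin.zero ∷ w))   = refl
    mass-suc j (just (Fin.suc Fin.zero ∷ w))           = sym (zeroʳ γ)
    mass-suc j (just (Fin.suc (Fin.suc Fin.zero) ∷ w)) = sym (zeroʳ γ)

    -- The pieces take at most half of the current cylinder, whose rescaled mass is γ^j.
    Light : ℕ → (ℕ → Maybe Word) → Set
    Light j F = ∀ N → fromℕ 2 * Σ< N (λ i → mass j (F i)) ≤ γ ^ j

    light-drop : ∀ {j F} → Light (suc j) F → Light j (restrict 0₃ ∘ F)
    light-drop {j} {F} light N = *-cancelˡ-≤ 0<γ (≤-trans
      (≤-reflexive (trans (solve 3 (λ g t s → g :* (t :* s) := t :* (g :* s)) refl γ (fromℕ 2) _)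
        (*-congˡ (sym (Σ-scale γ N (λ i → mass-suc j (F i)))))))
      (light N))

    -- If the pieces took more than half of both children, they would take more than half of γ (1 +
    -- γ^m) = 1 at the parent.
    light-branch : ∀ {F} → Light 0 F → ¬ Light 0 (restrict 0₃ ∘ F) → Light m (restrict 1₃ ∘ F)
    light-branch {F} light ¬light₀ N₁ = ≮⇒≥ λ heavy₁ →
      let (N₀ , heavy₀) = heavy
          -- The two children may become heavy at different partial sums; terms are nonnegative, so
          -- both remain heavy at `N`.
          N  = N₀ ℕ.+ N₁
          S₀ = Σ< N (λ i → mass 0 (restrict 0₃ (F i)))
          S₁ = Σ< N (λ i → mass m (restrict 1₃ (F i)))
      in <⇒≱ (begin-strict
        1#                         ≈⟨ γ-root ⟨
        γ * (1# + γ ^ m)           <⟨ *-monoˡ-< 0<γ (+-mono-<-≤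
            (<-≤-trans heavy₀ (*-monoˡ-≤ (0≤fromℕ 2) (Σ-monoˡ (λ i → 0≤mass 0 (restrict 0₃ (F i))) (ℕ.m≤m+n N₀ N₁))))
            (≤-trans (<⇒≤ heavy₁) (*-monoˡ-≤ (0≤fromℕ 2) (Σ-monoˡ (λ i → 0≤mass m (restrict 1₃ (F i))) (ℕ.m≤n+m N₁ N₀))))) ⟩
        γ * (fromℕ 2 * S₀ + fromℕ 2 * S₁) ≈⟨ solve 4 (λ g t a b → g :* (t :* a :+ t :* b) := t :* (g :* (a :+ b))) refl γ (fromℕ 2) S₀ S₁ ⟩
        fromℕ 2 * (γ * (S₀ + S₁))  ≈⟨ *-congˡ (trans (*-congˡ (sym (Σ-+ {λ i → mass 0 (restrict 0₃ (F i))} {λ i → mass m (restrict 1₃ (F i))} N)))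
                                        (sym (Σ-scale γ N (λ i → mass-zero (F i))))) ⟩
        fromℕ 2 * Σ< N (λ i → mass 0 (F i)) ∎)
      (light N)
      where
      heavy : ∃[ N ] (1# < fromℕ 2 * Σ< N (λ i → mass 0 (restrict 0₃ (F i))))
      heavy with decide (∃[ N ] (1# < fromℕ 2 * Σ< N (λ i → mass 0 (restrict 0₃ (F i)))))
      ... | yes found = found
      ... | no ¬found = contradiction (λ N → ≮⇒≥ λ lt → ¬found (N , lt)) ¬light₀

    light-step : ∀ j F → Light j F → ∃[ a ] ∃[ j′ ] (Step m j (toℕ {3} a) j′ × Light j′ (restrict a ∘ F))
    light-step (suc j) F light = 0₃ , j , drop , light-drop {j} {F} light
    light-step zero    F light with decide (Light 0 (restrict 0₃ ∘ F))
    ... | yes light₀ = 0₃ , 0 , stay , light₀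
    ... | no ¬light₀ = 1₃ , m , jump , light-branch {F} light ¬light₀

    word : ℤ₃ → ℕ → Word
    word c zero    = []
    word c (suc n) = c 0 ∷ word (c ∘ suc) n

    length-word : ∀ c n → length (word c n) ≡ n
    length-word c zero    = ≡.refl
    length-word c (suc n) = ≡.cong suc (length-word (c ∘ suc) n)

    -- Repeating the choice of `light-step` gives an infinite path on which all pieces together stay
    -- light. They are followed simultaneously, each cut down by the digits chosen.
    light-path : ∀ {F} → Light 0 F →
      ∃[ x ] (x ∈ 𝒞 (L (suc m)) × (∀ {i c n} → F i ≡ just (word c n) → ¬ x ∈ Cylinder c n))
    light-path {F} light = x , path⇒𝒞 {σ = λ t → proj₁ (position t)} (≡.refl , λ t → proj₁ (proj₂ (proj₂ (step t)))) , avoids 0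
      where
      Position : Set
      Position = ∃[ j ] ∃ (Light j)

      step-from : (p : Position) → ∃[ a ] ∃[ j′ ] (Step m (proj₁ p) (toℕ {3} a) j′ × Light j′ (restrict a ∘ proj₁ (proj₂ p)))
      step-from (j , G , light) = light-step j G light

      position : ℕ → Position
      position zero    = 0 , F , light
      position (suc t) =
        let (a , j′ , _ , light′) = step-from (position t)
        in j′ , restrict a ∘ proj₁ (proj₂ (position t)) , light′

      step : ∀ t → _
      step t = step-from (position t)

      x : ℤ₃
      x t = proj₁ (step t)

      remaining : ℕ → ℕ → Maybe Word
      remaining t = proj₁ (proj₂ (position t))

      avoids : ∀ t {i c n} → remaining t i ≡ just (word c n) → ¬ (∀ k → k ℕ.< n → x (t ℕ.+ k) ≡ c k)
      -- The word is used up: piece i contains the current cylinder and alone has the whole mass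
      -- γ^j, which is more than half.
      avoids t {i} {c} {zero} eq _ = <⇒≱ (begin-strict
        γ ^ j                          ≈⟨ trans (*-congʳ fromℕ1≈1) (*-identityˡ _) ⟨
        fromℕ 1 * γ ^ j                <⟨ ≤-<-trans (≤-reflexive (*-comm _ _)) (<-≤-trans (*-monoˡ-< (0<^ j 0<γ) (fromℕ<fromℕ-suc 1)) (≤-reflexive (*-comm _ _))) ⟩
        fromℕ 2 * γ ^ j                ≡⟨ ≡.cong (λ p → fromℕ 2 * mass j p) eq ⟨
        fromℕ 2 * mass j (remaining t i) ≤⟨ *-monoˡ-≤ (0≤fromℕ 2) (term≤Σ {λ i → mass j (remaining t i)} i (λ i → 0≤mass j (remaining t i))) ⟩
        fromℕ 2 * Σ< (suc i) (λ i → mass j (remaining t i)) ∎)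
        (proj₂ (proj₂ (position t)) (suc i))
        where
        j = proj₁ (position t)
      avoids t {i} {c} {suc n} eq agree = avoids (suc t) {i} {c ∘ suc} {n}
        (≡.trans (≡.cong (restrict (x t)) eq)
          (restrict-∷ (word (c ∘ suc) n) (≡.trans (≡.cong x (≡.sym (ℕ.+-identityʳ t))) (agree 0 (s≤s z≤n)))))
        (λ k k<n → ≡.trans (≡.cong x (≡.sym (ℕ.+-suc t k))) (agree (suc k) (s≤s k<n)))

    half : Carrier
    half = fromℕ 2 ⁻¹

    half+half : ∀ c → c * half + c * half ≈ c
    half+half c = trans (solve 2 (λ c h → c :* h :+ c :* h := c :* (numeral 2 :* h)) refl c half)
      (trans (*-congˡ (x*x⁻¹ (0<fromℕ-suc 1))) (*-identityʳ c))

    0<half : 0# < half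
    0<half = 0<⁻¹ (0<fromℕ-suc 1)

    -- The terms c / 2^(i+1): tolerances for infinitely many enlargements within a total of c.
    halves : Carrier → ℕ → Carrier
    halves c zero    = c * half
    halves c (suc i) = halves (c * half) i

    0<halves : ∀ {c} i → 0# < c → 0# < halves c i
    0<halves zero    0<c = 0<* 0<c 0<half
    0<halves (suc i) 0<c = 0<halves i (0<* 0<c 0<half)

    Σ-halves : ∀ {c} N → 0# ≤ c → Σ< N (halves c) ≤ c
    Σ-halves zero    0≤c = 0≤c
    Σ-halves {c} (suc N) 0≤c = ≤-trans
      (+-monoʳ-≤ (c * half) (Σ-halves N (*-nonNeg 0≤c (<⇒≤ 0<half))))
      (≤-reflexive (half+half c))

    -- If the diameter is 3^(-n), then 3^s ≤ β gives γ^n ≤ 3^(-ns) directly. If `U` has at most one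
    -- point, its power is 0 and `w` pays for a sufficiently long cylinder.
    enclose : ∀ U {s w} → 0# < s → s < ℓ β → 0# < w →
      ∃[ c ] ∃[ n ] (U ⊆ Cylinder c n × γ ^ n ≤ pow (diam U) s + w)
    enclose U {s} {w} 0<s s<ℓβ 0<w = [ small , large ]′ (diam-cases U)
      where
      Result = ∃[ c ] ∃[ n ] (U ⊆ Cylinder c n × γ ^ n ≤ pow (diam U) s + w)

      -- An empty `U` lies in every cylinder, so any centre serves.
      centre : ∃[ c ] (∀ {x} → x ∈ U → c ∈ U)
      centre with decide (∃ U)
      ... | yes (c , c∈U) = c , λ _ → c∈U
      ... | no ¬point     = (λ _ → 0₃) , λ x∈U → contradiction (_ , x∈U) ¬point

      c = proj₁ centre

      small : (∀ {x y} → x ∈ U → y ∈ U → ∀ j → x j ≡ y j) → Result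
      small equal =
        let (n , big) = ^-unbounded 1<β (1# ÷ w)
        in c , n , (λ x∈U j _ → equal x∈U (proj₂ centre x∈U) j) , *-cancelˡ-≤ (0<^ n 0<β) (begin
          β ^ n * γ ^ n   ≈⟨ βⁿ*γⁿ≈1 n ⟩
          1#              ≈⟨ ÷-cancel 1# 0<w ⟨
          w * (1# ÷ w)    ≤⟨ *-monoˡ-≤ (<⇒≤ 0<w) (<⇒≤ (big n ℕ.≤-refl)) ⟩
          w * β ^ n       ≈⟨ *-comm _ _ ⟩
          β ^ n * w       ≈⟨ *-congˡ (trans (+-congʳ (pow-base-0 (diam≈0 equal) 0<s)) (+-identityˡ w)) ⟨
          β ^ n * (pow (diam U) s + w) ∎)

      large : ∃[ n ] ((∀ {x y} → x ∈ U → y ∈ U → AgreeBelow n x y) × diam U ≈ 3⁻ n) → Result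
      large (n , agree , diam≈) =
        let (T , 1≤T , ℓT≈s) = exp₃ (<⇒≤ 0<s)
            T≤β = ℓ-cancel-≤ 1≤β (≤-trans (≤-reflexive ℓT≈s) (<⇒≤ s<ℓβ))
            yTⁿ≈1 = pow-base-3⁻ⁿ n (trans (*-congʳ diam≈) (3⁻ⁿ*3ⁿ≈1 n)) (<⇒≤ 0<s) 1≤T ℓT≈s
            y = pow (diam U) s
            0≤y : 0# ≤ y
            0≤y = ≮⇒≥ λ y<0 → <⇒≱ 0<1 (≤-resp-≈ yTⁿ≈1 (zeroˡ _) (*-monoʳ-≤ (0≤^ n (1≤⇒0≤ 1≤T)) (<⇒≤ y<0)))
        in c , n , (λ x∈U → agree x∈U (proj₂ centre x∈U)) , *-cancelˡ-≤ (0<^ n 0<β) (begin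
          β ^ n * γ ^ n   ≈⟨ trans (βⁿ*γⁿ≈1 n) (sym yTⁿ≈1) ⟩
          y * T ^ n       ≤⟨ *-monoˡ-≤ 0≤y (^-monoˡ-≤ n (1≤⇒0≤ 1≤T) T≤β) ⟩
          y * β ^ n       ≈⟨ *-comm _ _ ⟩
          β ^ n * y       ≤⟨ *-monoˡ-≤ (0≤^ n (<⇒≤ 0<β)) (x≤x+y y (<⇒≤ 0<w)) ⟩
          β ^ n * (y + w) ∎)

    ¬null-below : ∀ {s} → 0# < s → s < ℓ β → ¬ HausdorffNull (𝒞 (L (suc m))) s
    ¬null-below {s} 0<s s<ℓβ null = proj₂ (proj₂ avoiding) {i} ≡.refl (proj₁ (proj₂ (proj₂ (enclosed i))) x∈Uᵢ)
      where
      -- One quarter bounds the cover, another the enlargements: together half of the mass 1 at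
      -- state 0.
      quarter = half * half
      0<quarter = 0<* 0<half 0<half

      covering = null 1# quarter 0<1 0<quarter
      U = proj₁ covering

      y : ℕ → Carrier
      y i = pow (diam (U i)) s

      enclosed : ∀ i → ∃[ c ] ∃[ n ] (U i ⊆ Cylinder c n × γ ^ n ≤ y i + halves quarter i)
      enclosed i = enclose (U i) 0<s s<ℓβ (0<halves i 0<quarter)

      F : ℕ → Maybe Word
      F i = just (word (proj₁ (enclosed i)) (proj₁ (proj₂ (enclosed i))))

      mass-F : ∀ i → mass 0 (F i) ≤ y i + halves quarter i
      mass-F i =
        let (c , n , _ , γⁿ≤) = enclosed i
        in ≤-trans (wordMass-≤ 0 (word c n)) (≤-trans (≤-reflexive (reflexive (≡.cong (γ ^_) (length-word c n)))) γⁿ≤)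

      light : Light 0 F
      light N = begin
        fromℕ 2 * Σ< N (λ i → mass 0 (F i))                     ≤⟨ *-monoˡ-≤ (0≤fromℕ 2) (Σ-mono N mass-F) ⟩
        fromℕ 2 * Σ< N (λ i → y i + halves quarter i)           ≈⟨ *-congˡ (Σ-+ {y} {halves quarter} N) ⟩
        fromℕ 2 * (Σ< N y + Σ< N (halves quarter))              ≤⟨ *-monoˡ-≤ (0≤fromℕ 2) (+-mono-≤ (proj₂ (proj₂ (proj₂ covering)) N) (Σ-halves N (<⇒≤ 0<quarter))) ⟩
        fromℕ 2 * (quarter + quarter)                           ≈⟨ *-congˡ (half+half half) ⟩
        fromℕ 2 * half                                          ≈⟨ x*x⁻¹ (0<fromℕ-suc 1) ⟩
        1#                                                      ∎

      avoiding = light-path {F} light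
      covered = proj₁ (proj₂ covering) (proj₁ (proj₂ avoiding))
      i = proj₁ covered
      x∈Uᵢ = proj₂ covered

    -- No positive exponent below `ℓ β` is null and every exponent above it is. `dimH` returns some
    -- greatest lower bound, and any two agree.
    dimH-𝒞 : dimH (𝒞 (L (suc m))) ≈ ℓ β
    dimH-𝒞 = antisym (proj₂ isGlb (dimH E) (proj₁ spec)) (proj₂ spec (ℓ β) (proj₁ isGlb))
      where
      E = 𝒞 (L (suc m))

      Null : Pred Carrier (lsuc 0ℓ)
      Null s = 0# < s × HausdorffNull E s

      isGlb : IsGlb Null (ℓ β)
      isGlb = (λ s (0<s , null) → ≮⇒≥ λ s<ℓβ → ¬null-below 0<s s<ℓβ null) ,
        λ u below → ≮⇒≥ λ ℓβ<u →
          let (d , 0<d , u≈ℓβ+d) = difference-< ℓβ<u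
              d/2 = d * half
              0<d/2 = 0<* 0<d 0<half
              s = ℓ β + d/2
              s<u = <-≤-trans (x<x+y s 0<d/2) (≤-reflexive (trans (+-assoc _ _ _) (trans (+-congˡ (half+half d)) (sym u≈ℓβ+d))))
          in <⇒≱ s<u (below s (≤-<-trans (0≤ℓ 1≤β) (x<x+y _ 0<d/2) , null-above (x<x+y _ 0<d/2)))

      spec : IsGlb Null (dimH E)
      spec = the₁-spec {IsGlb Null} (ℓ β , isGlb)

-- The root β, the number e and the asymptotic estimate

module Asymptotics (em : ExcludedMiddle (lsuc 0ℓ)) (R : CompleteOrderedField) where

  open OrderedField em R
  open Logarithm em R
  open Hausdorff em R

  -- Subtraction

  x-y+y≈x : ∀ x y → x - y + y ≈ x
  x-y+y≈x x y = trans (+-assoc x (- y) y) (trans (+-congˡ (-‿inverseˡ y)) (+-identityʳ x))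

  x-y≈z⇒x≈z+y : ∀ {x y z} → x - y ≈ z → x ≈ z + y
  x-y≈z⇒x≈z+y {x} {y} eq = trans (sym (x-y+y≈x x y)) (+-congʳ eq)

  x≈z+y⇒x-y≈z : ∀ {x y z} → x ≈ z + y → x - y ≈ z
  x≈z+y⇒x-y≈z {x} {y} eq = +-cancelʳ y (trans (x-y+y≈x x y) eq)

  ∣-∣≤-intro : ∀ {x y z} → x ≤ y + z → y ≤ x + z → ∣ x - y ∣≤ z
  ∣-∣≤-intro {x} {y} {z} x≤y+z y≤x+z =
    +-cancelʳ-≤ y (begin
      x - y + y               ≈⟨ x-y+y≈x x y ⟩
      x                       ≤⟨ x≤y+z ⟩
      y + z                   ≈⟨ +-comm y z ⟩
      z + y                   ∎) ,
    +-cancelʳ-≤ x (begin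
      - (x - y) + x           ≈⟨ +-congˡ (x-y+y≈x x y) ⟨
      - (x - y) + (x - y + y) ≈⟨ +-assoc _ _ _ ⟨
      - (x - y) + (x - y) + y ≈⟨ trans (+-congʳ (-‿inverseˡ (x - y))) (+-identityˡ y) ⟩
      y                       ≤⟨ y≤x+z ⟩
      x + z                   ≈⟨ +-comm x z ⟩
      z + x                   ∎)

  -- The root β

  ^-lipschitz : ∀ n {b} → 0# ≤ b → ∃[ c ] (0# ≤ c × (∀ {x h} → 0# ≤ x → 0# ≤ h → x + h ≤ b → (x + h) ^ n ≤ x ^ n + c * h))
  ^-lipschitz zero    0≤b = 0# , ≤-refl , λ {x} {h} _ _ _ → ≤-reflexive (sym (trans (+-congˡ (zeroˡ h)) (+-identityʳ 1#)))
  ^-lipschitz (suc n) {b} 0≤b =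
    let (c , 0≤c , bound) = ^-lipschitz n 0≤b
    -- The constant follows the product rule: b^n bounds x^n, and c b bounds c (x + h).
    in b ^ n + c * b , 0≤+ (0≤^ n 0≤b) (*-nonNeg 0≤c 0≤b) , λ {x} {h} 0≤x 0≤h x+h≤b → begin
      (x + h) * (x + h) ^ n                  ≤⟨ *-monoˡ-≤ (0≤+ 0≤x 0≤h) (bound 0≤x 0≤h x+h≤b) ⟩
      (x + h) * (x ^ n + c * h)              ≈⟨ solve 4 (λ x h p c → (x :+ h) :* (p :+ c :* h) := x :* p :+ (p :+ c :* (x :+ h)) :* h) refl x h (x ^ n) c ⟩
      x ^ suc n + (x ^ n + c * (x + h)) * h  ≤⟨ +-monoʳ-≤ _ (*-monoʳ-≤ 0≤h (+-mono-≤
          (^-monoˡ-≤ n 0≤x (≤-trans (x≤x+y x 0≤h) x+h≤b)) (*-monoˡ-≤ 0≤c x+h≤b))) ⟩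
      x ^ suc n + (b ^ n + c * b) * h        ∎

  -- The choice h = g / (c + g) meets both bounds at once.
  small-multiple : ∀ {c g} → 0# ≤ c → 0# < g → ∃[ h ] (0# < h × h ≤ 1# × c * h < g)
  small-multiple {c} {g} 0≤c 0<g = h , 0<h , *-cancelˡ-≤ 0<c+g (begin
      (c + g) * h    ≈⟨ [c+g]h≈g ⟩
      g              ≤⟨ x≤x+y g 0≤c ⟩
      g + c          ≈⟨ trans (+-comm g c) (sym (*-identityʳ _)) ⟩
      (c + g) * 1#   ∎) , (begin-strict
      c * h          <⟨ x<x+y _ (0<* 0<g 0<h) ⟩
      c * h + g * h  ≈⟨ solve 3 (λ c g h → c :* h :+ g :* h := (c :+ g) :* h) refl c g h ⟩
      (c + g) * h    ≈⟨ [c+g]h≈g ⟩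
      g              ∎)
    where
    0<c+g : 0# < c + g
    0<c+g = <-≤-trans 0<g (≤-trans (x≤x+y g 0≤c) (≤-reflexive (+-comm g c)))
    h = g ÷ (c + g)
    0<h = 0<* 0<g (0<⁻¹ 0<c+g)
    [c+g]h≈g = ÷-cancel g 0<c+g

  module Root (m : ℕ) where

    isRoot⇒≈ : ∀ {β} → IsRoot>1 (suc m) β → β ^ suc m ≈ β ^ m + 1#
    isRoot⇒≈ {β} (_ , eq) = trans (x-y≈z⇒x≈z+y (trans (x-y≈z⇒x≈z+y eq) (+-identityˡ 1#))) (+-comm 1# _)

    ≈⇒isRoot : ∀ {β} → 1# < β → β ^ suc m ≈ β ^ m + 1# → IsRoot>1 (suc m) β
    ≈⇒isRoot 1<β eq = 1<β , x≈z+y⇒x-y≈z (trans (x≈z+y⇒x-y≈z (trans eq (+-comm _ 1#))) (sym (+-identityˡ 1#)))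

    -- Subtracting β^m from the equation leaves β^m (β - 1) = 1, whose left side increases with β.
    -- Uniqueness and the growth estimates start from this form.
    excess : ∀ {β} → 1# < β → β ^ suc m ≈ β ^ m + 1# → ∃[ δ ] (0# < δ × β ≈ 1# + δ × β ^ m * δ ≈ 1#)
    excess {β} 1<β eq =
      let (δ , 0<δ , β≈1+δ) = difference-< 1<β
      in δ , 0<δ , β≈1+δ , +-cancelʳ (β ^ m) (trans
           (solve 2 (λ p d → p :* d :+ p := (con 1 :+ d) :* p) refl (β ^ m) δ)
           (trans (*-congʳ (sym β≈1+δ)) (trans eq (+-comm _ _))))

    root-unique-≤ : ∀ {x y} → IsRoot>1 (suc m) x → IsRoot>1 (suc m) y → x ≤ y
    root-unique-≤ {x} {y} rx ry = ≮⇒≥ λ y<x →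
      let (d , 0<d , y≈1+d , yᵐd≈1) = excess (proj₁ ry) (isRoot⇒≈ ry)
          (c , 0<c , x≈1+c , xᵐc≈1) = excess (proj₁ rx) (isRoot⇒≈ rx)
          0<y = 1≤⇒0< (<⇒≤ (proj₁ ry))
          d<c = transfer-< (<-resp-≈ y≈1+d x≈1+c y<x) (solve 2 (λ c d → d :+ (con 1 :+ c) := c :+ (con 1 :+ d)) refl c d)
      in <⇒≱ (begin-strict
           1#          ≈⟨ yᵐd≈1 ⟨
           y ^ m * d   <⟨ *-monoˡ-< (0<^ m 0<y) d<c ⟩
           y ^ m * c   ≤⟨ *-monoʳ-≤ (<⇒≤ 0<c) (^-monoˡ-≤ m (<⇒≤ 0<y) (<⇒≤ y<x)) ⟩
           x ^ m * c   ≈⟨ xᵐc≈1 ⟩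
           1#          ∎) ≤-refl

    -- Here x^m (x - 1) ≤ 1 ≤ x^m. This bounds the set whose supremum is the root, and later gives δ
    -- ≤ 1.
    ≤2 : ∀ {x} → 1# ≤ x → x ^ suc m ≤ x ^ m + 1# → x ≤ fromℕ 2
    ≤2 {x} 1≤x le = *-cancelˡ-≤ (0<^ m (1≤⇒0< 1≤x)) (begin
      x ^ m * x          ≈⟨ *-comm _ _ ⟩
      x * x ^ m          ≤⟨ le ⟩
      x ^ m + 1#         ≤⟨ +-monoʳ-≤ _ (1≤^ m 1≤x) ⟩
      x ^ m + x ^ m      ≈⟨ solve 1 (λ p → p :+ p := p :* numeral 2) refl (x ^ m) ⟩
      x ^ m * fromℕ 2    ∎)

    Below : Pred Carrier 0ℓ
    Below x = 1# ≤ x × x ^ suc m ≤ x ^ m + 1#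

    1∈Below : Below 1#
    1∈Below = ≤-refl , ≤-trans (≤-reflexive (*-identityˡ _)) (x≤x+y _ 0≤1)

    -- Intermediate value argument at the supremum of `Below`, with `^-lipschitz` in place of
    -- continuity: a strict inequality in either direction leaves room for a step h. The root is not
    -- 1, since that would give 2 ≤ 1.
    root-exists : ∃ (IsRoot>1 (suc m))
    root-exists = T , ≈⇒isRoot 1<T T-root
      where
      sup = complete Below (1# , 1∈Below) (fromℕ 2 , λ x (1≤x , le) → ≤2 1≤x le)
      T = proj₁ sup
      ub = proj₁ (proj₂ sup)

      1≤T : 1# ≤ T
      1≤T = ub 1# 1∈Below

      T≤2 : T ≤ fromℕ 2
      T≤2 = proj₂ (proj₂ sup) (fromℕ 2) λ x (1≤x , le) → ≤2 1≤x le

      -- The points considered are at most 2 and the steps at most 1, hence the interval [0, 3].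
      lip = ^-lipschitz (suc m) (<⇒≤ 0<3)
      c = proj₁ lip
      0≤c = proj₁ (proj₂ lip)

      ≤3 : ∀ {x h} → x ≤ fromℕ 2 → h ≤ 1# → x + h ≤ three
      ≤3 x≤2 h≤1 = ≤-trans (+-mono-≤ x≤2 h≤1) (≤-reflexive (+-comm _ _))

      T-root : T ^ suc m ≈ T ^ m + 1#
      T-root = antisym (≮⇒≥ too-big) (≮⇒≥ too-small)
        where
        too-small : ¬ (T ^ suc m < T ^ m + 1#)
        too-small lt =
          let (g , 0<g , eq) = difference-< lt
              (h , 0<h , h≤1 , ch<g) = small-multiple 0≤c 0<g
              0≤h = <⇒≤ 0<h
          in <⇒≱ (x<x+y T 0<h) (ub (T + h) (≤-trans 1≤T (x≤x+y T 0≤h) , (begin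
            (T + h) ^ suc m      ≤⟨ proj₂ (proj₂ lip) (1≤⇒0≤ 1≤T) 0≤h (≤3 T≤2 h≤1) ⟩
            T ^ suc m + c * h    ≤⟨ +-monoʳ-≤ _ (<⇒≤ ch<g) ⟩
            T ^ suc m + g        ≈⟨ eq ⟨
            T ^ m + 1#           ≤⟨ +-monoˡ-≤ 1# (^-monoˡ-≤ m (1≤⇒0≤ 1≤T) (x≤x+y T 0≤h)) ⟩
            (T + h) ^ m + 1#     ∎)))

        too-big : ¬ (T ^ m + 1# < T ^ suc m)
        too-big lt =
          let (g , 0<g , eq) = difference-< lt
              (h , 0<h , h≤1 , ch<g) = small-multiple 0≤c 0<g
              T-h<T = <-≤-trans (x<x+y (T - h) 0<h) (≤-reflexive (x-y+y≈x T h))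
              (x , (1≤x , le) , T-h<x) = lub-approx {Below} (proj₂ sup) T-h<T
              0≤x = 1≤⇒0≤ 1≤x
          in <⇒≱ (begin-strict
            T ^ suc m            ≤⟨ ^-monoˡ-≤ (suc m) (1≤⇒0≤ 1≤T) (≤-trans (≤-reflexive (sym (x-y+y≈x T h))) (+-monoˡ-≤ h (<⇒≤ T-h<x))) ⟩
            (x + h) ^ suc m      ≤⟨ proj₂ (proj₂ lip) 0≤x (<⇒≤ 0<h) (≤3 (≤2 1≤x le) h≤1) ⟩
            x ^ suc m + c * h    ≤⟨ +-monoˡ-≤ _ le ⟩
            x ^ m + 1# + c * h   ≤⟨ +-monoˡ-≤ _ (+-monoˡ-≤ 1# (^-monoˡ-≤ m 0≤x (ub x (1≤x , le)))) ⟩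
            T ^ m + 1# + c * h   ≈⟨ +-comm _ _ ⟩
            c * h + (T ^ m + 1#) <⟨ +-mono-<-≤ ch<g ≤-refl ⟩
            g + (T ^ m + 1#)     ≈⟨ +-comm _ _ ⟩
            T ^ m + 1# + g       ≈⟨ eq ⟨
            T ^ suc m            ∎) ≤-refl

      1<T : 1# < T
      1<T = [ (λ lt → lt) , (λ T≤1 → ⊥-elim (<⇒≱ (x<x+y 1# 0<1) (begin
        1# + 1#        ≤⟨ +-monoˡ-≤ 1# (1≤^ m 1≤T) ⟩
        T ^ m + 1#     ≈⟨ T-root ⟨
        T ^ suc m      ≤⟨ ^-≤1 (suc m) (1≤⇒0≤ 1≤T) T≤1 ⟩
        1#             ∎))) ]′ (<-or-≥ 1# T)

    root-exists-unique : ∃! _≈_ (IsRoot>1 (suc m))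
    root-exists-unique =
      let (β , root) = root-exists
      in β , root , λ root′ → antisym (root-unique-≤ root root′) (root-unique-≤ root′ root)

  -- The number e

  1/! : ℕ → Carrier
  1/! j = fromℕ (j !) ⁻¹

  0<fromℕ! : ∀ j → 0# < fromℕ (j !)
  0<fromℕ! j = <-≤-trans 0<1 (≤-trans (≤-reflexive (sym fromℕ1≈1)) (fromℕ-mono-≤ (ℕ.1≤n! j)))

  0<1/! : ∀ j → 0# < 1/! j
  0<1/! j = 0<⁻¹ (0<fromℕ! j)

  1/!-suc : ∀ j → fromℕ (suc j) * 1/! (suc j) ≈ 1/! j
  1/!-suc j = *-cancelˡ (0<fromℕ! j) (begin-equality
    fromℕ (j !) * (fromℕ (suc j) * 1/! (suc j)) ≈⟨ solve 3 (λ f s i → f :* (s :* i) := (s :* f) :* i) refl (fromℕ (j !)) (fromℕ (suc j)) (1/! (suc j)) ⟩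
    fromℕ (suc j) * fromℕ (j !) * 1/! (suc j)   ≈⟨ *-congʳ (fromℕ-* (suc j) (j !)) ⟨
    fromℕ (suc j !) * 1/! (suc j)               ≈⟨ x*x⁻¹ (0<fromℕ! (suc j)) ⟩
    1#                                          ≈⟨ x*x⁻¹ (0<fromℕ! j) ⟨
    fromℕ (j !) * 1/! j                         ∎)

  Σ-geometric : ∀ {f : ℕ → Carrier} N → (∀ i → 0# ≤ f i) → (∀ i → f (suc i) + f (suc i) ≤ f i) → Σ< N f ≤ f 0 + f 0
  Σ-geometric zero    0≤f halving = 0≤+ (0≤f 0) (0≤f 0)
  Σ-geometric {f} (suc N) 0≤f halving = +-monoʳ-≤ (f 0)
    (≤-trans (Σ-geometric {f ∘ suc} N (0≤f ∘ suc) (halving ∘ suc)) (halving 0))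

  -- The bound e < 3 makes `ln` dominate `ℓ` and gives ln 3 > 1, so that ln (ln 3) is positive.
  e-data : 1# < e × e < three
  e-data = <-≤-trans 1<S₂ (proj₁ e-lub _ (2 , refl)) , ≤-<-trans (proj₂ e-lub B below-B) B<3
    where
    Partial : Pred Carrier 0ℓ
    Partial x = ∃[ n ] x ≈ Σ< n 1/!

    t = 1/! 3
    1/!0≈1 : 1/! 0 ≈ 1#
    1/!0≈1 = trans (sym (*-identityˡ _)) (trans (*-congʳ (sym fromℕ1≈1)) (x*x⁻¹ (0<fromℕ! 0)))
    1/!1≈1 : 1/! 1 ≈ 1#
    1/!1≈1 = trans (sym (*-identityˡ _)) (trans (*-congʳ (sym fromℕ1≈1)) (trans (1/!-suc 0) 1/!0≈1))
    6t≈1 : fromℕ 2 * (three * t) ≈ 1#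
    6t≈1 = trans (*-congˡ (1/!-suc 2)) (trans (1/!-suc 1) 1/!1≈1)

    -- With t = 1/6 this is 1 + 1 + 1/2 + 2/6: from 1/3! on the terms at least halve, so that tail
    -- is at most 2 t.
    B = 1# + (1# + (three * t + (t + t)))

    halving : ∀ i → 1/! (4 ℕ.+ i) + 1/! (4 ℕ.+ i) ≤ 1/! (3 ℕ.+ i)
    halving i = begin
      1/! (4 ℕ.+ i) + 1/! (4 ℕ.+ i)            ≈⟨ solve 1 (λ x → x :+ x := numeral 2 :* x) refl (1/! (4 ℕ.+ i)) ⟩
      fromℕ 2 * 1/! (4 ℕ.+ i)                  ≤⟨ *-monoʳ-≤ (<⇒≤ (0<1/! (4 ℕ.+ i))) (fromℕ-mono-≤ {2} {4 ℕ.+ i} (s≤s (s≤s z≤n))) ⟩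
      fromℕ (4 ℕ.+ i) * 1/! (4 ℕ.+ i)          ≈⟨ 1/!-suc (3 ℕ.+ i) ⟩
      1/! (3 ℕ.+ i)                            ∎

    below-B : ∀ x → Partial x → x ≤ B
    below-B x (n , x≈Σ) = begin
      x                ≈⟨ x≈Σ ⟩
      Σ< n 1/!         ≤⟨ Σ-monoˡ {1/!} (λ j → <⇒≤ (0<1/! j)) (ℕ.m≤n+m n 3) ⟩
      1/! 0 + (1/! 1 + (1/! 2 + Σ< n (λ j → 1/! (3 ℕ.+ j))))
                       ≤⟨ +-mono-≤ (≤-reflexive 1/!0≈1) (+-mono-≤ (≤-reflexive 1/!1≈1) (+-mono-≤ (≤-reflexive (sym (1/!-suc 2)))
                            (Σ-geometric {λ j → 1/! (3 ℕ.+ j)} n (λ j → <⇒≤ (0<1/! (3 ℕ.+ j))) halving))) ⟩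
      B                ∎

    B<3 : B < three
    B<3 = begin-strict
      B                                       <⟨ x<x+y B (0<1/! 3) ⟩
      B + t                                   ≈⟨ solve 1 (λ t → (con 1 :+ (con 1 :+ (numeral 3 :* t :+ (t :+ t)))) :+ t
                                                   := con 1 :+ (con 1 :+ numeral 2 :* (numeral 3 :* t))) refl t ⟩
      1# + (1# + fromℕ 2 * (three * t))       ≈⟨ +-congˡ (+-congˡ (trans 6t≈1 (sym (+-identityʳ 1#)))) ⟩
      three                                   ∎

    1<S₂ : 1# < Σ< 2 1/!
    1<S₂ = <-≤-trans (x<x+y 1# 0<1) (≤-reflexive (+-cong (sym 1/!0≈1) (trans (sym 1/!1≈1) (sym (+-identityʳ _)))))

    e-lub : IsLub Partial e
    e-lub = the-spec {IsLub Partial} (complete Partial (0# , 0 , refl) (B , below-B))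

  1<e = proj₁ e-data
  e<3 = proj₂ e-data

  0<ℓe : 0# < ℓ e
  0<ℓe = 0<ℓ 1<e

  ℓe<1 : ℓ e < 1#
  ℓe<1 = <-≤-trans (ℓ-mono-< (<⇒≤ 1<e) e<3) (≤-reflexive ℓ-3)

  ln-ℓ : ∀ {x} → 1# ≤ x → ln x * ℓ e ≈ ℓ x
  ln-ℓ = log-ℓ 1<e

  ln-mono : ∀ {x y} → 1# ≤ x → x ≤ y → ln x ≤ ln y
  ln-mono {x} {y} 1≤x x≤y = *-cancelˡ-≤ 0<ℓe (begin
    ℓ e * ln x   ≈⟨ trans (*-comm _ _) (ln-ℓ 1≤x) ⟩
    ℓ x          ≤⟨ ℓ-mono 1≤x x≤y ⟩
    ℓ y          ≈⟨ trans (*-comm _ _) (ln-ℓ (≤-trans 1≤x x≤y)) ⟨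
    ℓ e * ln y   ∎)

  ℓ≤ln : ∀ {x} → 1# ≤ x → ℓ x ≤ ln x
  ℓ≤ln {x} 1≤x = begin
    ℓ x          ≈⟨ ln-ℓ 1≤x ⟨
    ln x * ℓ e   ≤⟨ *-monoˡ-≤ 0≤ln (<⇒≤ ℓe<1) ⟩
    ln x * 1#    ≈⟨ *-identityʳ _ ⟩
    ln x         ∎
    where
    0≤ln : 0# ≤ ln x
    0≤ln = *-cancelˡ-≤ 0<ℓe (≤-trans (≤-reflexive (zeroʳ _)) (≤-trans (0≤ℓ 1≤x) (≤-reflexive (sym (trans (*-comm _ _) (ln-ℓ 1≤x))))))

  1<ln3 : 1# < ln three
  1<ln3 = [ (λ lt → lt) , (λ ln3≤1 → ⊥-elim (<⇒≱ ℓe<1 (begin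
    1#               ≈⟨ ℓ-3 ⟨
    ℓ three          ≈⟨ ln-ℓ (<⇒≤ 1<3) ⟨
    ln three * ℓ e   ≤⟨ *-monoʳ-≤ (<⇒≤ 0<ℓe) ln3≤1 ⟩
    1# * ℓ e         ≈⟨ *-identityˡ _ ⟩
    ℓ e              ∎))) ]′ (<-or-≥ 1# (ln three))

  -- k = 3 is the smallest case, so ln (ln k) stays away from 0 and can absorb constants.
  0<lnln3 : 0# < ln (ln three)
  0<lnln3 = <-≤-trans (0<ℓ 1<ln3) (ℓ≤ln (<⇒≤ 1<ln3))

  -- Bounds for the root

  module Growth (m : ℕ) (3≤k : 3 ℕ.≤ suc m) {β} (root : IsRoot>1 (suc m) β) where

    open Root m

    κ = fromℕ (suc m)
    1<β = proj₁ root
    1≤β = <⇒≤ 1<β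
    0<β = 1≤⇒0< 1≤β
    β-root = isRoot⇒≈ root
    δ-data = excess 1<β β-root
    δ = proj₁ δ-data
    0<δ = proj₁ (proj₂ δ-data)
    β≈1+δ = proj₁ (proj₂ (proj₂ δ-data))
    βᵐδ≈1 = proj₂ (proj₂ (proj₂ δ-data))

    1≤κ : 1# ≤ κ
    1≤κ = 1≤fromℕ-suc m

    0<κ : 0# < κ
    0<κ = 0<fromℕ-suc m

    3≤κ : three ≤ κ
    3≤κ = fromℕ-mono-≤ 3≤k

    1≤ℓκ : 1# ≤ ℓ κ
    1≤ℓκ = ≤-trans (≤-reflexive (sym ℓ-3)) (ℓ-mono (<⇒≤ 1<3) 3≤κ)

    β≤2 : β ≤ fromℕ 2
    β≤2 = ≤2 1≤β (≤-reflexive β-root)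

    δ≤1 : δ ≤ 1#
    δ≤1 = +-cancelʳ-≤ 1# (begin
      δ + 1#    ≈⟨ trans (+-comm _ _) (sym β≈1+δ) ⟩
      β         ≤⟨ β≤2 ⟩
      fromℕ 2   ≈⟨ +-congˡ fromℕ1≈1 ⟩
      1# + 1#   ∎)

    -- Bernoulli in reverse: β^n - 1 is δ times a sum of n powers, each at most β^n. At n = m the
    -- factor δ β^m is 1, whence β^m ≤ k.
    βⁿ≤1+nδβⁿ : ∀ n → β ^ n ≤ 1# + fromℕ n * (δ * β ^ n)
    βⁿ≤1+nδβⁿ zero    = x≤x+y 1# (≤-reflexive (sym (zeroˡ _)))
    βⁿ≤1+nδβⁿ (suc n) = begin
      β * β ^ n                                ≤⟨ *-monoˡ-≤ (<⇒≤ 0<β) (βⁿ≤1+nδβⁿ n) ⟩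
      β * (1# + fromℕ n * (δ * β ^ n))         ≈⟨ solve 4 (λ b n d p → b :* (con 1 :+ n :* (d :* p)) := b :+ n :* (d :* (b :* p))) refl β (fromℕ n) δ (β ^ n) ⟩
      β + fromℕ n * (δ * β ^ suc n)            ≈⟨ +-congʳ β≈1+δ ⟩
      1# + δ + fromℕ n * (δ * β ^ suc n)       ≤⟨ +-monoˡ-≤ _ (+-monoʳ-≤ 1# (≤-trans (≤-reflexive (sym (*-identityʳ δ))) (*-monoˡ-≤ (<⇒≤ 0<δ) (1≤^ (suc n) 1≤β)))) ⟩
      1# + δ * β ^ suc n + fromℕ n * (δ * β ^ suc n) ≈⟨ solve 2 (λ n x → con 1 :+ x :+ n :* x := con 1 :+ (con 1 :+ n) :* x) refl (fromℕ n) (δ * β ^ suc n) ⟩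
      1# + fromℕ (suc n) * (δ * β ^ suc n)     ∎

    βᵐ≤κ : β ^ m ≤ κ
    βᵐ≤κ = ≤-trans (βⁿ≤1+nδβⁿ m) (≤-reflexive (+-congˡ (trans (*-congˡ (trans (*-comm δ _) βᵐδ≈1)) (*-identityʳ _))))

    κℓβ≈ℓβᵏ : κ * ℓ β ≈ ℓ (β ^ suc m)
    κℓβ≈ℓβᵏ = sym (ℓ-^ (suc m) 1≤β)

    κℓβ≤1+ℓκ : κ * ℓ β ≤ 1# + ℓ κ
    κℓβ≤1+ℓκ = begin
      κ * ℓ β              ≈⟨ κℓβ≈ℓβᵏ ⟩
      ℓ (β ^ suc m)        ≤⟨ ℓ-mono (1≤^ (suc m) 1≤β) (*-mono-≤ (<⇒≤ 0<β) (0≤^ m (<⇒≤ 0<β)) (≤-trans β≤2 (<⇒≤ (fromℕ<fromℕ-suc 2))) βᵐ≤κ) ⟩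
      ℓ (three * κ)        ≈⟨ ℓ-* (<⇒≤ 1<3) 1≤κ ⟩
      ℓ three + ℓ κ        ≈⟨ +-congʳ ℓ-3 ⟩
      1# + ℓ κ             ∎

    -- For n one more than the integer part of 2 / δ, Bernoulli gives β^n ≥ 1 + n δ ≥ 3, hence n ℓ β
    -- ≥ 1, while δ n ≤ 2 + δ ≤ 3.
    δ≤3ℓβ : δ ≤ three * ℓ β
    δ≤3ℓβ = begin
      δ                  ≈⟨ trans (*-congˡ fromℕ1≈1) (*-identityʳ δ) ⟨
      δ * fromℕ 1        ≤⟨ *-monoˡ-≤ (<⇒≤ 0<δ) (ℓ-lower 1 a 1≤β 3≤βⁿ) ⟩
      δ * (n * ℓ β)      ≈⟨ *-assoc _ _ _ ⟨
      δ * n * ℓ β        ≤⟨ *-monoʳ-≤ (0≤ℓ 1≤β) δn≤3 ⟩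
      three * ℓ β        ∎
      where
      split = floor (<⇒≤ (0<* (0<fromℕ-suc 1) (0<⁻¹ 0<δ)))
      a = proj₁ split
      n = fromℕ (suc a)

      δn≤3 : δ * n ≤ three
      δn≤3 = begin
        δ * (1# + fromℕ a)      ≈⟨ solve 2 (λ d a → d :* (con 1 :+ a) := d :+ d :* a) refl δ (fromℕ a) ⟩
        δ + δ * fromℕ a         ≤⟨ +-mono-≤ δ≤1 (≤-trans (*-monoˡ-≤ (<⇒≤ 0<δ) (proj₁ (proj₂ split))) (≤-reflexive (÷-cancel (fromℕ 2) 0<δ))) ⟩
        three                   ∎

      3≤βⁿ : three ^ 1 ≤ β ^ suc a
      3≤βⁿ = begin
        three * 1#              ≈⟨ *-identityʳ three ⟩
        1# + fromℕ 2            ≈⟨ +-congˡ (÷-cancel (fromℕ 2) 0<δ) ⟨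
        1# + δ * (fromℕ 2 ÷ δ)  ≤⟨ +-monoʳ-≤ 1# (*-monoˡ-≤ (<⇒≤ 0<δ) (<⇒≤ (proj₂ (proj₂ split)))) ⟩
        1# + δ * n              ≈⟨ +-congˡ (*-comm δ n) ⟩
        1# + n * δ              ≤⟨ bernoulli (suc a) (<⇒≤ 0<δ) ⟩
        (1# + δ) ^ suc a        ≈⟨ ^-congˡ (suc a) β≈1+δ ⟨
        β ^ suc a               ∎

    six : Carrier
    six = fromℕ 6

    1≤6 : 1# ≤ six
    1≤6 = 1≤fromℕ-suc 5

    -- 6 is 3 from `δ≤3ℓβ` times 2 from 1 + ℓ κ ≤ 2 ℓ κ, which uses k ≥ 3.
    κδ≤6ℓκ : κ * δ ≤ six * ℓ κ
    κδ≤6ℓκ = begin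
      κ * δ                  ≤⟨ *-monoˡ-≤ (<⇒≤ 0<κ) δ≤3ℓβ ⟩
      κ * (three * ℓ β)      ≈⟨ solve 3 (λ k t l → k :* (t :* l) := t :* (k :* l)) refl κ three (ℓ β) ⟩
      three * (κ * ℓ β)      ≤⟨ *-monoˡ-≤ (<⇒≤ 0<3) (≤-trans κℓβ≤1+ℓκ (+-monoˡ-≤ _ 1≤ℓκ)) ⟩
      three * (ℓ κ + ℓ κ)    ≈⟨ solve 1 (λ l → numeral 3 :* (l :+ l) := numeral 6 :* l) refl (ℓ κ) ⟩
      six * ℓ κ              ∎

    -- Since β^m δ = 1, κ ≤ κ β = β^k (κ δ), so the bound on κ δ becomes a lower bound on β^k.
    ℓκ≤κℓβ+ : ℓ κ ≤ κ * ℓ β + (ℓ six + ℓ (ℓ κ))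
    ℓκ≤κℓβ+ = begin
      ℓ κ                               ≤⟨ ℓ-mono 1≤κ κ≤ ⟩
      ℓ (β ^ suc m * (six * ℓ κ))       ≈⟨ ℓ-* (1≤^ (suc m) 1≤β) (1≤* 1≤6 1≤ℓκ) ⟩
      ℓ (β ^ suc m) + ℓ (six * ℓ κ)     ≈⟨ +-cong (sym κℓβ≈ℓβᵏ) (ℓ-* 1≤6 1≤ℓκ) ⟩
      κ * ℓ β + (ℓ six + ℓ (ℓ κ))       ∎
      where
      κ≤ : κ ≤ β ^ suc m * (six * ℓ κ)
      κ≤ = begin
        κ                          ≈⟨ *-identityʳ κ ⟨
        κ * 1#                     ≤⟨ *-monoˡ-≤ (<⇒≤ 0<κ) 1≤β ⟩
        κ * β                      ≈⟨ *-congˡ (trans (*-congˡ βᵐδ≈1) (*-identityʳ β)) ⟨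
        κ * (β * (β ^ m * δ))      ≈⟨ solve 4 (λ k b p d → k :* (b :* (p :* d)) := (b :* p) :* (k :* d)) refl κ β (β ^ m) δ ⟩
        β ^ suc m * (κ * δ)        ≤⟨ *-monoˡ-≤ (0≤^ (suc m) (<⇒≤ 0<β)) κδ≤6ℓκ ⟩
        β ^ suc m * (six * ℓ κ)    ∎

  -- The first summand absorbs the constant 1 + ℓ 6, as ln (ln k) ≥ ln (ln 3) for k ≥ 3; the second
  -- pays for ℓ (ℓ k) ≤ ln (ln k).
  K : Carrier
  K = (1# + ℓ (fromℕ 6)) ÷ ln (ln three) + 1#

  module _ (m : ℕ) (3≤k : 3 ℕ.≤ suc m) {β} (root : IsRoot>1 (suc m) β) where

    open Growth m 3≤k root

    private
      λκ = ln (ln κ)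
      C = 1# + ℓ six

    ln3≤lnκ : ln three ≤ ln κ
    ln3≤lnκ = ln-mono (<⇒≤ 1<3) 3≤κ

    C+lnln≤Klnln : C + λκ ≤ K * λκ
    C+lnln≤Klnln = begin
      C + λκ                                  ≈⟨ +-congʳ (÷-cancel C 0<lnln3) ⟨
      ln (ln three) * (C ÷ ln (ln three)) + λκ ≤⟨ +-monoˡ-≤ λκ (*-monoʳ-≤
          (*-nonNeg (0≤+ 0≤1 (0≤ℓ 1≤6)) (<⇒≤ (0<⁻¹ 0<lnln3))) (ln-mono (<⇒≤ 1<ln3) ln3≤lnκ)) ⟩
      λκ * (C ÷ ln (ln three)) + λκ           ≈⟨ solve 2 (λ l c → l :* c :+ l := (c :+ con 1) :* l) refl λκ (C ÷ ln (ln three)) ⟩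
      K * λκ                                  ∎

    0≤λκ : 0# ≤ λκ
    0≤λκ = ≤-trans (<⇒≤ 0<lnln3) (ln-mono (<⇒≤ 1<ln3) ln3≤lnκ)

    ℓℓκ≤λκ : ℓ (ℓ κ) ≤ λκ
    ℓℓκ≤λκ = ≤-trans (ℓ-mono 1≤ℓκ (ℓ≤ln 1≤κ)) (ℓ≤ln (≤-trans 1≤ℓκ (ℓ≤ln 1≤κ)))

    dimension-asymptotics : ∣ ℓ β - ℓ κ ÷ κ ∣≤ K * (λκ ÷ κ)
    dimension-asymptotics = ∣-∣≤-intro
      (*-cancelˡ-≤ 0<κ (begin
        κ * ℓ β                           ≤⟨ κℓβ≤1+ℓκ ⟩
        1# + ℓ κ                          ≤⟨ +-monoˡ-≤ _ (x≤x+y 1# (0≤+ (0≤ℓ 1≤6) 0≤λκ)) ⟩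
        1# + (ℓ six + λκ) + ℓ κ           ≈⟨ trans (+-congʳ (sym (+-assoc _ _ _))) (+-comm _ _) ⟩
        ℓ κ + (C + λκ)                    ≤⟨ +-monoʳ-≤ _ C+lnln≤Klnln ⟩
        ℓ κ + K * λκ                      ≈⟨ +-cong (÷-cancel (ℓ κ) 0<κ) κ*rest ⟨
        κ * (ℓ κ ÷ κ) + κ * (K * (λκ ÷ κ)) ≈⟨ solve 3 (λ k a b → k :* a :+ k :* b := k :* (a :+ b)) refl κ (ℓ κ ÷ κ) (K * (λκ ÷ κ)) ⟩
        κ * (ℓ κ ÷ κ + K * (λκ ÷ κ))      ∎))
      (*-cancelˡ-≤ 0<κ (begin
        κ * (ℓ κ ÷ κ)                     ≈⟨ ÷-cancel (ℓ κ) 0<κ ⟩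
        ℓ κ                               ≤⟨ ℓκ≤κℓβ+ ⟩
        κ * ℓ β + (ℓ six + ℓ (ℓ κ))       ≤⟨ +-monoʳ-≤ _ (+-mono-≤ (≤-trans (x≤x+y _ 0≤1) (≤-reflexive (+-comm _ _))) ℓℓκ≤λκ) ⟩
        κ * ℓ β + (C + λκ)                ≤⟨ +-monoʳ-≤ _ C+lnln≤Klnln ⟩
        κ * ℓ β + K * λκ                  ≈⟨ +-congˡ κ*rest ⟨
        κ * ℓ β + κ * (K * (λκ ÷ κ))      ≈⟨ solve 3 (λ k a b → k :* a :+ k :* b := k :* (a :+ b)) refl κ (ℓ β) (K * (λκ ÷ κ)) ⟩
        κ * (ℓ β + K * (λκ ÷ κ))          ∎))
      where
      κ*rest : κ * (K * (λκ ÷ κ)) ≈ K * λκ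
      κ*rest = trans (solve 3 (λ k K q → k :* (K :* q) := K :* (k :* q)) refl κ K (λκ ÷ κ)) (*-congˡ (÷-cancel λκ 0<κ))

theorem1p7 :
    (∀ k → 1 ℕ.≤ k → HasExactlyVertices (L k) k × StronglyConnected (L k)) ×
    ((em : ExcludedMiddle (lsuc 0ℓ)) (R : CompleteOrderedField) →
     let open Analysis em R in
     (∀ k → 1 ℕ.≤ k →
        ∃! _≈_ (IsRoot>1 k) ×
        (∀ β → IsRoot>1 k β → dimH (𝒞 (L k)) ≈ log (fromℕ 3) β)) ×
     (∃[ K ] (∀ k → 3 ℕ.≤ k →
        ∣ dimH (𝒞 (L k)) - log (fromℕ 3) (fromℕ k) ÷ fromℕ k ∣≤
          K * (ln (ln (fromℕ k)) ÷ fromℕ k))))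
theorem1p7 = graph , analysis
  where
  graph : ∀ k → 1 ℕ.≤ k → HasExactlyVertices (L k) k × StronglyConnected (L k)
  graph (suc m) _ = Automaton.vertices m , Automaton.stronglyConnected m

  module _ (em : ExcludedMiddle (lsuc 0ℓ)) (R : CompleteOrderedField) where
    open OrderedField em R
    open Logarithm em R
    open Hausdorff em R
    open Asymptotics em R

    dimension : ∀ m {β} → IsRoot>1 (suc m) β → dimH (𝒞 (L (suc m))) ≈ ℓ β
    dimension m {β} root = PathSet.dimH-𝒞 m β (proj₁ root) (Root.isRoot⇒≈ m root)

    roots : ∀ k → 1 ℕ.≤ k → ∃! _≈_ (IsRoot>1 k) × (∀ β → IsRoot>1 k β → dimH (𝒞 (L k)) ≈ log (fromℕ 3) β)
    roots (suc m) _ = Root.root-exists-unique m ,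
      λ β root → trans (dimension m root) (sym (log₃≈ℓ (<⇒≤ (proj₁ root))))

    asymptotics : ∀ k → 3 ℕ.≤ k →
      ∣ dimH (𝒞 (L k)) - log (fromℕ 3) (fromℕ k) ÷ fromℕ k ∣≤ K * (ln (ln (fromℕ k)) ÷ fromℕ k)
    asymptotics (suc m) 3≤k =
      let (β , root)        = Root.root-exists m
          (upper , lower)   = dimension-asymptotics m 3≤k root
          same = +-cong (dimension m root) (-‿cong (*-congʳ (log₃≈ℓ (1≤fromℕ-suc m))))
      in ≤-resp-≈ (sym same) refl upper , ≤-resp-≈ (-‿cong (sym same)) refl lower

    analysis = roots , K , asymptotics
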